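{- Let $k\ge1$ be an integer. We have $$G^{(k-1)(k-2)\cdots1k}_{13\text{ - }2}(x)=x^kC^2(x),$$ where $C^2(x)=(C(x))^2$. Hence $$N^{(k-1)(k-2)\cdots1k}_{13\text{ - }2}(n)=\begin{cases}C_{n-(k-1)},&\text{if }n\ge k,\\0,&\text{otherwise.}\end{cases}$$
   Context: A permutation $\pi=\pi_1\cdots\pi_n$ of $\{1,\dots,n\}$ contains the generalized pattern $13\text{ - }2$ if there are indices $i,j$ with $i+1<j\le n$ such that $\pi_i\pi_{i+1}\pi_j$ is order-isomorphic to $132$; otherwise it avoids it. A permutation $\pi$ begins with a pattern $p=p_1\cdots p_k$ if $n\ge k$ and $\pi_1\cdots\pi_k$ is order-isomorphic to $p$; in addition, by convention, the empty permutation is assumed to begin with the pattern $1$. The pattern $(k-1)(k-2)\cdots1k$ consists of $k-1,k-2,\dots,1$ in decreasing order followed by $k$ (for $k=1$ it is $1$, for $k=2$ it is $12$). $N^p_q(n)$ is the number of permutations of $\{1,\dots,n\}$ that avoid $q$ and begin with $p$, and $G^p_q(x)=\sum_{n\ge0}N^p_q(n)x^n$ is the ordinary generating function. $C(x)=\sum_{n\ge0}C_nx^n=\frac{1-\sqrt{1-4x}}{2x}$, with $C_n=\frac1{n+1}\binom{2n}{n}$ the Catalan numbers.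
   Formalization: Since by convention the empty permutation begins with the pattern 1, the printed claim fails at k=1, n=0 (there N=1, not 0); for k=1 the generating function is stated as 1+xC²(x), and the formula for N excludes (k,n)=(1,0). -}

module Defs where

open import Data.Fin.Base using (Fin; toℕ; fromℕ; inject₁; _<_)
open import Data.Fin.Patterns using (0F; 1F; 2F)
import Data.Fin.Properties as Fin
open import Data.List.Base as List using (List; filter; cartesianProductWith; upTo)
open import Data.Nat.Base as ℕ using (ℕ; zero; suc; NonZero)
open import Data.Nat.ListAction using (sum)
import Data.Nat.Properties as ℕ
open import Data.Nat.Combinatorics renaming (_C_ to _choose_)
open import Data.Nat.DivMod using (_/_)
open import Data.Product.Base using (_×_; _,_; Σ-syntax; ∃-syntax)
open import Data.Sum.Base using (_⊎_)
open import Data.Vec.Base as Vec using (Vec; []; _∷_; _∷ʳ_; lookup; truncate)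
open import Data.Vec.Relation.Unary.AllPairs using (allPairs?)
open import Data.Vec.Relation.Unary.Unique.Propositional using (Unique)
open import Function.Bundles using (_⇔_; mk⇔; Equivalence)
open import Relation.Binary.PropositionalEquality using (_≡_)
open import Relation.Nullary.Decidable
  using (Dec; yes; no; ¬?; map′; _×-dec_; _⊎-dec_; _→-dec_)
open import Relation.Nullary.Negation using (¬_)
open import Relation.Unary using (Decidable)

-- Permutations of {1,…,n} and patterns are written in one-line notation, as
-- words of length n in Fin n without repeated letters; the element i : Fin n
-- stands for the letter toℕ i + 1, and also for the position toℕ i + 1.

IsPermutation : ∀ {n} → Vec (Fin n) n → Set
IsPermutation = Unique

OrderIsomorphic : ∀ {a b k} → Vec (Fin a) k → Vec (Fin b) k → Set
OrderIsomorphic {k = k} σ τ =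
  ∀ (i j : Fin k) → lookup σ i < lookup σ j ⇔ lookup τ i < lookup τ j

p132 : Vec (Fin 3) 3
p132 = 0F ∷ 2F ∷ 1F ∷ []

-- The entries at positions i and i′ are adjacent; j is anywhere to their right.
Contains13-2 : ∀ {n} → Vec (Fin n) n → Set
Contains13-2 {n} π =
  ∃[ i ] ∃[ i′ ] ∃[ j ]
    toℕ i′ ≡ suc (toℕ i) × i′ < j ×
    OrderIsomorphic (lookup π i ∷ lookup π i′ ∷ lookup π j ∷ []) p132

Avoids13-2 : ∀ {n} → Vec (Fin n) n → Set
Avoids13-2 π = ¬ Contains13-2 π

-- The second alternative is the convention that the empty permutation begins
-- with the pattern 1, which is the only pattern of length one.
BeginsWith : ∀ {k n} → Vec (Fin k) k → Vec (Fin n) n → Set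
BeginsWith {k} {n} p π =
    (Σ[ k≤n ∈ k ℕ.≤ n ] OrderIsomorphic (truncate k≤n π) p)
  ⊎ (k ≡ 1 × n ≡ 0)

-- The pattern (k-1)(k-2)⋯1k.
descentsThenMax : ∀ k .{{_ : NonZero k}} → Vec (Fin k) k
descentsThenMax (suc m) = Vec.map inject₁ (Vec.reverse (Vec.allFin m)) ∷ʳ fromℕ m

infix 4 _⇔-dec_

_⇔-dec_ : ∀ {A B : Set} → Dec A → Dec B → Dec (A ⇔ B)
a? ⇔-dec b? =
  map′ (λ (f , g) → mk⇔ f g) (λ e → Equivalence.to e , Equivalence.from e)
       ((a? →-dec b?) ×-dec (b? →-dec a?))

isPermutation? : ∀ {n} → Decidable (IsPermutation {n})
isPermutation? = allPairs? (λ x y → ¬? (x Fin.≟ y))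

orderIsomorphic? : ∀ {a b k} (σ : Vec (Fin a) k) (τ : Vec (Fin b) k) →
                   Dec (OrderIsomorphic σ τ)
orderIsomorphic? σ τ = Fin.all? λ i → Fin.all? λ j →
  (lookup σ i Fin.<? lookup σ j) ⇔-dec (lookup τ i Fin.<? lookup τ j)

avoids13-2? : ∀ {n} → Decidable (Avoids13-2 {n})
avoids13-2? π = ¬? (Fin.any? λ i → Fin.any? λ i′ → Fin.any? λ j →
  (toℕ i′ ℕ.≟ suc (toℕ i)) ×-dec (i′ Fin.<? j) ×-dec
  orderIsomorphic? (lookup π i ∷ lookup π i′ ∷ lookup π j ∷ []) p132)

beginsWith? : ∀ {k n} (p : Vec (Fin k) k) → Decidable (BeginsWith {k} {n} p)
beginsWith? {k} {n} p π = prefix? ⊎-dec ((k ℕ.≟ 1) ×-dec (n ℕ.≟ 0))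
  where
  prefix? : Dec (Σ[ k≤n ∈ k ℕ.≤ n ] OrderIsomorphic (truncate k≤n π) p)
  prefix? with k ℕ.≤? n
  ... | no  k≰n = no λ (k≤n , _) → k≰n k≤n
  ... | yes k≤n = map′ (k≤n ,_)
    (λ { (k≤n′ , e) → substIrr k≤n′ e }) (orderIsomorphic? (truncate k≤n π) p)
    where
    substIrr : ∀ k≤n′ → OrderIsomorphic (truncate k≤n′ π) p →
               OrderIsomorphic (truncate k≤n π) p
    substIrr k≤n′ e rewrite ℕ.≤-irrelevant k≤n k≤n′ = e

-- All words of length n over Fin m, each listed exactly once.
words : ∀ m n → List (Vec (Fin m) n)
words m zero    = List.[ [] ]
words m (suc n) = cartesianProductWith _∷_ (List.allFin m) (words m n)

permutations : ∀ n → List (Vec (Fin n) n)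
permutations n = filter isPermutation? (words n n)

-- N p n is the number of permutations of {1,…,n} avoiding 13-2 and beginning
-- with p.
N : ∀ {k} → Vec (Fin k) k → ℕ → ℕ
N p n = List.length (filter (beginsWith? p) (filter avoids13-2? (permutations n)))

-- Formal power series with natural number coefficients: f n is the
-- coefficient of xⁿ.
Series : Set
Series = ℕ → ℕ

infixl 6 _⊕_
infixl 7 _⊛_
infixr 8 _^ˢ_

1ˢ : Series
1ˢ zero    = 1
1ˢ (suc _) = 0

X : Series
X 1 = 1
X _ = 0

_⊕_ : Series → Series → Series
(f ⊕ g) n = f n ℕ.+ g n

_⊛_ : Series → Series → Series
(f ⊛ g) n = sum (List.map (λ i → f i ℕ.* g (n ℕ.∸ i)) (upTo (suc n)))

_^ˢ_ : Series → ℕ → Series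
f ^ˢ zero  = 1ˢ
f ^ˢ suc m = f ⊛ f ^ˢ m

G : ∀ {k} → Vec (Fin k) k → Series
G p n = N p n

-- n + 1 divides the binomial coefficient, so nothing is rounded off.
catalan : ℕ → ℕ
catalan n = ((2 ℕ.* n) choose n) / suc n

C : Series
C n = catalan n

{-# OPTIONS --safe #-}

-- A permutation avoiding 13-2 avoids the pattern 132 altogether, so it is the
-- output of a run of a stack into which n, …, 1 are pushed in this order. A
-- permutation beginning with (k-1)⋯1k must begin with consecutive letters
-- m+k-1, …, m+1, m+k, since a letter strictly between m+1 and the k-th letter
-- could only follow later and complete a 132. What follows is the completion
-- of a stack run with the letters 1, …, m still to be pushed. The number of
-- completions depends only on m and on the n-k-m letters on the stack; it is
-- a ballot number, and summing over m gives the ballot number C_{n-k+1}.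
module Submission where

open import Defs
open import Data.Nat.Base using (ℕ; _∸_; _≤_; _<_; NonZero)
open import Data.Product.Base using (_×_)
open import Relation.Binary.PropositionalEquality using (_≡_; _≢_; _≗_)
open import Relation.Nullary.Negation using (¬_)

open import Data.Fin.Base as Fin using (Fin; toℕ; fromℕ; fromℕ<; inject₁; opposite)
open import Data.Fin.Patterns using (0F; 1F; 2F)
import Data.Fin.Properties as Fin
open import Data.Fin.Relation.Unary.Top using (view; ‵fromℕ; ‵inject₁)
open import Data.List.Base
  using (List; []; _∷_; [_]; _++_; _∷ʳ_; map; length; filter; iterate; upTo; applyUpTo;
         applyDownFrom; initLast; _∷ʳ′_)
open import Data.List.Membership.Propositional using (_∈_)
open import Data.List.Membership.Propositional.Properties
open import Data.List.Membership.Propositional.Properties.WithK using (unique∧set⇒bag)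
open import Data.List.Properties
  using (length-map; length-++; length-applyDownFrom; map-cong; map-upTo; map-++; filter-none;
         ∷-injective; ∷-injectiveˡ; ∷-injectiveʳ; ++-assoc; ++-cancelˡ)
open import Data.List.Relation.Binary.BagAndSetEquality using (∼bag⇒↭)
open import Data.List.Relation.Binary.Permutation.Propositional.Properties using (↭-length)
open import Data.List.Relation.Unary.All as All using (All; []; _∷_)
import Data.List.Relation.Unary.All.Properties as All
open import Data.List.Relation.Unary.AllPairs as AllPairs using (AllPairs; []; _∷_)
import Data.List.Relation.Unary.AllPairs.Properties as AllPairs
open import Data.List.Relation.Unary.Any using (here; there)
open import Data.List.Relation.Unary.Unique.Propositional using (Unique)
import Data.List.Relation.Unary.Unique.Propositional.Properties as Unique
open import Data.Nat.Base using (zero; suc; _+_; _*_; _/_; _>_; z≤n; s≤s; z<s; s≤s⁻¹)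
open import Data.Nat.Combinatorics using (nCk≡nC[n∸k]; nCn≡1; nC1≡n; nCk+nC[k+1]≡[n+1]C[k+1])
  renaming (_C_ to _choose_)
open import Data.Nat.DivMod using (m*n/n≡m)
open import Data.Nat.ListAction using (sum)
open import Data.Nat.Properties
open import Data.Nat.Solver using (module +-*-Solver)
open import Data.Product.Base using (_,_; proj₁; proj₂; ∃-syntax; Σ-syntax)
open import Data.Sum.Base as Sum using (_⊎_; inj₁; inj₂)
open import Data.Vec.Base as Vec using (Vec; []; _∷_; lookup; truncate)
import Data.Vec.Membership.DecPropositional as VecMembership using (_∈?_)
import Data.Vec.Membership.Propositional as VecMembership
import Data.Vec.Membership.Propositional.Properties as VecMembership
import Data.Vec.Properties as Vec
open import Data.Vec.Relation.Unary.All as VecAll using ([]; _∷_)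
import Data.Vec.Relation.Unary.All.Properties as VecAll
open import Data.Vec.Relation.Unary.AllPairs as VecAllPairs using ([]; _∷_)
import Data.Vec.Relation.Unary.Unique.Propositional.Properties as VecUnique
open import Function.Base using (_∘_; id)
open import Function.Bundles using (mk⇔; Equivalence; _⇔_)
open import Relation.Binary.Definitions using (tri<; tri≈; tri>)
open import Relation.Binary.PropositionalEquality
  using (refl; sym; trans; cong; cong₂; subst; subst₂; module ≡-Reasoning)
open import Relation.Nullary.Decidable using (yes; no)
open import Relation.Nullary.Negation using (contradiction)

-- Avoidance alone is not an inductive invariant of a stack run: midway, the stack also prescribes
-- the order in which its letters leave. `Completes` therefore adds that the letters from b on come
-- out increasingly. At the start this is vacuous, a pop preserves it, and a push may lower the
-- threshold because of the next letter of the output. The base m of an opening does the same for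
-- the rest of the word: standing in front of it, it forces the letters above m to rise, so the rest
-- is itself a completion. The sum over m needs no summation formula. Base m contributes
-- `ballot l m`, where l letters exceed the opening, and l grows by one as m falls by one; this is
-- the recurrence of `ballot (suc l) m` unrolled. From l = 0 the total is `ballot 1 m`, which is
-- C_{m+1} because the first push onto an empty stack is forced. For the series, `ballot d` belongs
-- to C^(d+1), so C² is the series of `ballot 1`.

-- Ballot and Catalan numbers

-- The number of ways to complete a stack-sorting run with d letters on the
-- stack and b letters still to be pushed.
ballot : ℕ → ℕ → ℕ
ballot d       zero    = 1
ballot zero    (suc b) = ballot 1 b
ballot (suc d) (suc b) = ballot d (suc b) + ballot (2 + d) b

+-exchange : ∀ a b c d → (a + b) + (c + d) ≡ (a + c) + (b + d)
+-exchange = solve 4 (λ a b c d → (a :+ b) :+ (c :+ d) := (a :+ c) :+ (b :+ d)) refl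
  where open +-*-Solver

choose-suc : ∀ n k → suc n choose suc k ≡ n choose k + n choose suc k
choose-suc n k = sym (nCk+nC[k+1]≡[n+1]C[k+1] n k)

-- Symmetry of an odd row of Pascal's triangle. It closes the empty-stack case of the reflection
-- principle, where the forced push leaves only one ballot term.
choose-middle : ∀ b → (1 + 2 * b) choose suc b ≡ (1 + 2 * b) choose b
choose-middle b = trans (nCk≡nC[n∸k] (s≤s (m≤m+n b (b + 0))))
  (cong ((1 + 2 * b) choose_) (trans (m+n∸m≡n b (b + 0)) (+-identityʳ b)))

choose-zero : ∀ n → n choose 0 ≡ 1
choose-zero n = trans (nCk≡nC[n∸k] {0} {n} z≤n) (nCn≡1 n)

-- The ratio (k+1) C(n,k+1) = (n-k) C(n,k) with the subtraction cleared, so that k > n is covered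
-- too. Pascal's rule reduces row n + 1 to two instances in row n.
choose-absorb : ∀ n k → suc k * (n choose suc k) + k * (n choose k) ≡ n * (n choose k)
choose-absorb zero    zero    = refl
choose-absorb zero    (suc k) = cong₂ _+_ (*-zeroʳ k) (*-zeroʳ k)
choose-absorb (suc n) zero    = begin
  1 * (suc n choose 1) + 0   ≡⟨ +-identityʳ _ ⟩
  1 * (suc n choose 1)       ≡⟨ *-identityˡ _ ⟩
  suc n choose 1             ≡⟨ nC1≡n (suc n) ⟩
  suc n                      ≡⟨ *-identityʳ (suc n) ⟨
  suc n * 1                  ≡⟨ cong (suc n *_) (choose-zero (suc n)) ⟨
  suc n * (suc n choose 0)   ∎
  where open ≡-Reasoning
choose-absorb (suc n) (suc k) = begin
  (2 + k) * (suc n choose (2 + k)) + suc k * (suc n choose suc k)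
    ≡⟨ cong₂ (λ x y → (2 + k) * x + suc k * y) (choose-suc n (suc k)) (choose-suc n k) ⟩
  (2 + k) * (b + c) + suc k * (a + b)
    ≡⟨ regroup k a b c ⟩
  ((2 + k) * c + suc k * b) + (suc k * b + k * a) + (a + b)
    ≡⟨ cong₂ (λ x y → x + y + (a + b)) (choose-absorb n (suc k)) (choose-absorb n k) ⟩
  n * b + n * a + (a + b)
    ≡⟨ collect n a b ⟩
  suc n * (a + b)
    ≡⟨ cong (suc n *_) (choose-suc n k) ⟨
  suc n * (suc n choose suc k) ∎
  where
  open ≡-Reasoning
  open +-*-Solver
  a = n choose k
  b = n choose suc k
  c = n choose (2 + k)
  regroup : ∀ k a b c → (2 + k) * (b + c) + suc k * (a + b) ≡
            ((2 + k) * c + suc k * b) + (suc k * b + k * a) + (a + b)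
  regroup = solve 4 (λ k a b c →
    (con 2 :+ k) :* (b :+ c) :+ (con 1 :+ k) :* (a :+ b) :=
    ((con 2 :+ k) :* c :+ (con 1 :+ k) :* b) :+ ((con 1 :+ k) :* b :+ k :* a) :+ (a :+ b)) refl
  collect : ∀ n a b → n * b + n * a + (a + b) ≡ suc n * (a + b)
  collect = solve 3 (λ n a b →
    n :* b :+ n :* a :+ (a :+ b) := (con 1 :+ n) :* (a :+ b)) refl

-- The reflection principle, with the subtracted binomial moved to the left.
ballot-choose : ∀ d b → ballot d (suc b) + (2 * suc b + d) choose b ≡ (2 * suc b + d) choose suc b
ballot-choose zero zero = refl
ballot-choose zero (suc b) = begin
  ballot 1 (suc b) + (2 * (2 + b) + 0) choose suc b
    ≡⟨ cong (λ x → ballot 1 (suc b) + x choose suc b) (index b) ⟩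
  ballot 1 (suc b) + suc n choose suc b
    ≡⟨ cong (ballot 1 (suc b) +_) (choose-suc n b) ⟩
  ballot 1 (suc b) + (n choose b + n choose suc b)
    ≡⟨ +-assoc (ballot 1 (suc b)) _ _ ⟨
  ballot 1 (suc b) + n choose b + n choose suc b
    ≡⟨ cong (λ x → ballot 1 (suc b) + x choose b + n choose suc b) (index′ b) ⟨
  ballot 1 (suc b) + (2 * suc b + 1) choose b + n choose suc b
    ≡⟨ cong (_+ n choose suc b) (ballot-choose 1 b) ⟩
  (2 * suc b + 1) choose suc b + n choose suc b
    ≡⟨ cong₂ (λ x y → x choose suc b + y) (index′ b) (sym (choose-middle (suc b))) ⟩
  n choose suc b + n choose (2 + b)
    ≡⟨ choose-suc n (suc b) ⟨
  suc n choose (2 + b)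
    ≡⟨ cong (_choose (2 + b)) (index b) ⟨
  (2 * (2 + b) + 0) choose (2 + b) ∎
  where
  open ≡-Reasoning
  open +-*-Solver
  n = 1 + 2 * suc b
  index : ∀ b → 2 * (2 + b) + 0 ≡ 2 + 2 * suc b
  index = solve 1 (λ b → con 2 :* (con 2 :+ b) :+ con 0 := con 2 :+ con 2 :* (con 1 :+ b)) refl
  index′ : ∀ b → 2 * suc b + 1 ≡ 1 + 2 * suc b
  index′ b = +-comm (2 * suc b) 1
ballot-choose (suc d) zero = begin
  ballot d 1 + 1 + (2 + suc d) choose 0     ≡⟨ cong (ballot d 1 + 1 +_) (choose-zero (2 + suc d)) ⟩
  ballot d 1 + 1 + 1                        ≡⟨ cong (λ x → ballot d 1 + x + 1) (choose-zero (2 + d)) ⟨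
  ballot d 1 + (2 + d) choose 0 + 1         ≡⟨ cong (_+ 1) (ballot-choose d 0) ⟩
  (2 + d) choose 1 + 1                      ≡⟨ +-comm _ 1 ⟩
  1 + (2 + d) choose 1                      ≡⟨ cong (_+ (2 + d) choose 1) (choose-zero (2 + d)) ⟨
  (2 + d) choose 0 + (2 + d) choose 1       ≡⟨ choose-suc (2 + d) 0 ⟨
  suc (2 + d) choose 1                      ≡⟨ cong (_choose 1) (+-suc 2 d) ⟨
  (2 + suc d) choose 1                      ∎
  where open ≡-Reasoning
ballot-choose (suc d) (suc b) = begin
  ballot d (2 + b) + ballot (2 + d) (suc b) + (2 * (2 + b) + suc d) choose suc b
    ≡⟨ cong (λ x → ballot d (2 + b) + ballot (2 + d) (suc b) + x choose suc b) (+-suc (2 * (2 + b)) d) ⟩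
  ballot d (2 + b) + ballot (2 + d) (suc b) + suc n choose suc b
    ≡⟨ cong (ballot d (2 + b) + ballot (2 + d) (suc b) +_) (trans (choose-suc n b) (+-comm (n choose b) _)) ⟩
  (ballot d (2 + b) + ballot (2 + d) (suc b)) + (n choose suc b + n choose b)
    ≡⟨ +-exchange (ballot d (2 + b)) _ _ _ ⟩
  (ballot d (2 + b) + n choose suc b) + (ballot (2 + d) (suc b) + n choose b)
    ≡⟨ cong₂ _+_ (ballot-choose d (suc b))
        (subst (λ x → ballot (2 + d) (suc b) + x choose b ≡ x choose suc b) (index b d) (ballot-choose (2 + d) b)) ⟩
  n choose (2 + b) + n choose suc b
    ≡⟨ trans (+-comm (n choose (2 + b)) _) (sym (choose-suc n (suc b))) ⟩
  suc n choose (2 + b)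
    ≡⟨ cong (_choose (2 + b)) (+-suc (2 * (2 + b)) d) ⟨
  (2 * (2 + b) + suc d) choose (2 + b) ∎
  where
  open ≡-Reasoning
  open +-*-Solver
  n = 2 * (2 + b) + d
  index : ∀ b d → 2 * suc b + (2 + d) ≡ 2 * (2 + b) + d
  index = solve 2 (λ b d → con 2 :* (con 1 :+ b) :+ (con 2 :+ d) := con 2 :* (con 2 :+ b) :+ d) refl

-- Reflection gives h + x = y for the neighbouring binomials x, y, and their ratio gives (b+2) x =
-- (b+1) y; multiplying the first equation by b + 2 leaves h (b+2) = y. The product form makes the
-- division in `catalan` exact.
ballot-central : ∀ n → ballot 0 n * suc n ≡ (2 * n) choose n
ballot-central zero    = refl
ballot-central (suc b) = +-cancelʳ-≡ (suc b * y) (h * (2 + b)) y (begin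
  h * (2 + b) + suc b * y              ≡⟨ cong (h * (2 + b) +_) absorb ⟨
  h * (2 + b) + (2 + b) * x            ≡⟨ cong (_+ (2 + b) * x) (*-comm h (2 + b)) ⟩
  (2 + b) * h + (2 + b) * x            ≡⟨ *-distribˡ-+ (2 + b) h x ⟨
  (2 + b) * (h + x)                    ≡⟨ cong ((2 + b) *_) reflection ⟩
  y + suc b * y                        ∎)
  where
  open ≡-Reasoning
  h = ballot 0 (suc b)
  x = (2 * suc b) choose b
  y = (2 * suc b) choose suc b
  reflection : h + x ≡ y
  reflection = subst (λ m → h + m choose b ≡ m choose suc b) (+-identityʳ (2 * suc b)) (ballot-choose 0 b)
  split : ∀ b x → (2 + b) * x + b * x ≡ 2 * suc b * x
  split = solve 2 (λ b x → (con 2 :+ b) :* x :+ b :* x := con 2 :* (con 1 :+ b) :* x) refl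
    where open +-*-Solver
  absorb : (2 + b) * x ≡ suc b * y
  absorb = +-cancelʳ-≡ (b * x) ((2 + b) * x) (suc b * y)
    (trans (split b x) (sym (choose-absorb (2 * suc b) b)))

catalan≡ballot : ∀ n → catalan n ≡ ballot 0 n
catalan≡ballot n = trans (cong (_/ suc n) (sym (ballot-central n))) (m*n/n≡m (ballot 0 n) (suc n))

-- Convolution of power series

⊛-suc : ∀ f g n → (f ⊛ g) (suc n) ≡ f 0 * g (suc n) + ((f ∘ suc) ⊛ g) n
⊛-suc f g n = begin
  sum (map F (upTo (2 + n)))                    ≡⟨ cong sum (map-upTo F (2 + n)) ⟩
  F 0 + sum (applyUpTo (F ∘ suc) (suc n))       ≡⟨ cong (λ xs → F 0 + sum xs) (map-upTo (F ∘ suc) (suc n)) ⟨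
  F 0 + sum (map (F ∘ suc) (upTo (suc n)))      ∎
  where
  open ≡-Reasoning
  F : ℕ → ℕ
  F i = f i * g (suc n ∸ i)

⊛-cong : ∀ f f′ g g′ → f ≗ f′ → g ≗ g′ → f ⊛ g ≗ f′ ⊛ g′
⊛-cong f f′ g g′ f≗ g≗ n = cong sum (map-cong (λ i → cong₂ _*_ (f≗ i) (g≗ (n ∸ i))) (upTo (suc n)))

⊛-congˡ : ∀ {f f′} g → f ≗ f′ → f ⊛ g ≗ f′ ⊛ g
⊛-congˡ {f} {f′} g f≗ = ⊛-cong f f′ g g f≗ (λ _ → refl)

⊛-distribʳ-⊕ : ∀ f g e → (f ⊕ g) ⊛ e ≗ (f ⊛ e) ⊕ (g ⊛ e)
⊛-distribʳ-⊕ f g e zero = begin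
  (f 0 + g 0) * e 0 + 0                   ≡⟨ cong (_+ 0) (*-distribʳ-+ (e 0) (f 0) (g 0)) ⟩
  f 0 * e 0 + g 0 * e 0 + (0 + 0)         ≡⟨ +-exchange (f 0 * e 0) _ 0 0 ⟩
  (f 0 * e 0 + 0) + (g 0 * e 0 + 0)       ∎
  where open ≡-Reasoning
⊛-distribʳ-⊕ f g e (suc n) = begin
  ((f ⊕ g) ⊛ e) (suc n)
    ≡⟨ ⊛-suc (f ⊕ g) e n ⟩
  (f 0 + g 0) * e (suc n) + (((f ∘ suc) ⊕ (g ∘ suc)) ⊛ e) n
    ≡⟨ cong₂ _+_ (*-distribʳ-+ (e (suc n)) (f 0) (g 0)) (⊛-distribʳ-⊕ (f ∘ suc) (g ∘ suc) e n) ⟩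
  (f 0 * e (suc n) + g 0 * e (suc n)) + (((f ∘ suc) ⊛ e) n + ((g ∘ suc) ⊛ e) n)
    ≡⟨ +-exchange (f 0 * e (suc n)) _ _ _ ⟩
  (f 0 * e (suc n) + ((f ∘ suc) ⊛ e) n) + (g 0 * e (suc n) + ((g ∘ suc) ⊛ e) n)
    ≡⟨ cong₂ _+_ (⊛-suc f e n) (⊛-suc g e n) ⟨
  ((f ⊛ e) ⊕ (g ⊛ e)) (suc n) ∎
  where open ≡-Reasoning

⊛-zeroˡ : ∀ f → (λ _ → 0) ⊛ f ≗ λ _ → 0
⊛-zeroˡ f zero    = refl
⊛-zeroˡ f (suc n) = trans (⊛-suc (λ _ → 0) f n) (⊛-zeroˡ f n)

⊛-identityˡ : ∀ f → 1ˢ ⊛ f ≗ f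
⊛-identityˡ f zero    = trans (+-identityʳ _) (*-identityˡ (f 0))
⊛-identityˡ f (suc n) = begin
  (1ˢ ⊛ f) (suc n)                        ≡⟨ ⊛-suc 1ˢ f n ⟩
  1 * f (suc n) + ((λ _ → 0) ⊛ f) n       ≡⟨ cong₂ _+_ (*-identityˡ (f (suc n))) (⊛-zeroˡ f n) ⟩
  f (suc n) + 0                           ≡⟨ +-identityʳ _ ⟩
  f (suc n)                               ∎
  where open ≡-Reasoning

⊛-identityʳ : ∀ f → f ⊛ 1ˢ ≗ f
⊛-identityʳ f zero    = trans (+-identityʳ _) (*-identityʳ (f 0))
⊛-identityʳ f (suc n) = begin
  (f ⊛ 1ˢ) (suc n)                  ≡⟨ ⊛-suc f 1ˢ n ⟩
  f 0 * 0 + ((f ∘ suc) ⊛ 1ˢ) n      ≡⟨ cong (_+ ((f ∘ suc) ⊛ 1ˢ) n) (*-zeroʳ (f 0)) ⟩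
  ((f ∘ suc) ⊛ 1ˢ) n                ≡⟨ ⊛-identityʳ (f ∘ suc) n ⟩
  f (suc n)                         ∎
  where open ≡-Reasoning

X∘suc : X ∘ suc ≗ 1ˢ
X∘suc zero    = refl
X∘suc (suc n) = refl

X^suc : ∀ k → (X ^ˢ suc k) ∘ suc ≗ X ^ˢ k
X^suc k n = begin
  (X ⊛ X ^ˢ k) (suc n)          ≡⟨ ⊛-suc X (X ^ˢ k) n ⟩
  ((X ∘ suc) ⊛ X ^ˢ k) n        ≡⟨ ⊛-congˡ (X ^ˢ k) X∘suc n ⟩
  (1ˢ ⊛ X ^ˢ k) n               ≡⟨ ⊛-identityˡ (X ^ˢ k) n ⟩
  (X ^ˢ k) n                    ∎
  where open ≡-Reasoning

X^⊛-shift : ∀ k f n → (X ^ˢ k ⊛ f) (n + k) ≡ f n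
X^⊛-shift zero    f n = trans (⊛-identityˡ f (n + 0)) (cong f (+-identityʳ n))
X^⊛-shift (suc k) f n = begin
  (X ^ˢ suc k ⊛ f) (n + suc k)                  ≡⟨ cong (X ^ˢ suc k ⊛ f) (+-suc n k) ⟩
  (X ^ˢ suc k ⊛ f) (suc (n + k))                ≡⟨ ⊛-suc (X ^ˢ suc k) f (n + k) ⟩
  (((X ^ˢ suc k) ∘ suc) ⊛ f) (n + k)            ≡⟨ ⊛-congˡ f (X^suc k) (n + k) ⟩
  (X ^ˢ k ⊛ f) (n + k)                          ≡⟨ X^⊛-shift k f n ⟩
  f n                                           ∎
  where open ≡-Reasoning

X^⊛-low : ∀ k f n → n < k → (X ^ˢ k ⊛ f) n ≡ 0
X^⊛-low (suc k) f zero    _         = refl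
X^⊛-low (suc k) f (suc n) (s≤s n<k) = begin
  (X ^ˢ suc k ⊛ f) (suc n)                ≡⟨ ⊛-suc (X ^ˢ suc k) f n ⟩
  (((X ^ˢ suc k) ∘ suc) ⊛ f) n            ≡⟨ ⊛-congˡ f (X^suc k) n ⟩
  (X ^ˢ k ⊛ f) n                          ≡⟨ X^⊛-low k f n n<k ⟩
  0                                       ∎
  where open ≡-Reasoning

-- Cutting a completion from d + 1 letters where the stack first drops to d
-- letters: the series of ballot d is the (d + 1)-st power of that of ballot 0.
ballot-⊛ : ∀ d → ballot d ⊛ ballot 0 ≗ ballot (suc d)
ballot-⊛ d zero = refl
ballot-⊛ zero (suc n) = begin
  (ballot 0 ⊛ ballot 0) (suc n)                          ≡⟨ ⊛-suc (ballot 0) (ballot 0) n ⟩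
  1 * ballot 0 (suc n) + (ballot 1 ⊛ ballot 0) n         ≡⟨ cong₂ _+_ (*-identityˡ (ballot 0 (suc n))) (ballot-⊛ 1 n) ⟩
  ballot 0 (suc n) + ballot 2 n                          ∎
  where open ≡-Reasoning
ballot-⊛ (suc d) (suc n) = begin
  (ballot (suc d) ⊛ ballot 0) (suc n)
    ≡⟨ ⊛-suc (ballot (suc d)) (ballot 0) n ⟩
  1 * c + (((ballot d ∘ suc) ⊕ ballot (2 + d)) ⊛ ballot 0) n
    ≡⟨ cong (1 * c +_) (⊛-distribʳ-⊕ (ballot d ∘ suc) (ballot (2 + d)) (ballot 0) n) ⟩
  1 * c + (((ballot d ∘ suc) ⊛ ballot 0) n + (ballot (2 + d) ⊛ ballot 0) n)
    ≡⟨ +-assoc (1 * c) _ _ ⟨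
  1 * c + ((ballot d ∘ suc) ⊛ ballot 0) n + (ballot (2 + d) ⊛ ballot 0) n
    ≡⟨ cong (1 * c + ((ballot d ∘ suc) ⊛ ballot 0) n +_) (ballot-⊛ (2 + d) n) ⟩
  ballot d 0 * c + ((ballot d ∘ suc) ⊛ ballot 0) n + ballot (3 + d) n
    ≡⟨ cong (_+ ballot (3 + d) n) (⊛-suc (ballot d) (ballot 0) n) ⟨
  (ballot d ⊛ ballot 0) (suc n) + ballot (3 + d) n
    ≡⟨ cong (_+ ballot (3 + d) n) (ballot-⊛ d (suc n)) ⟩
  ballot (2 + d) (suc n) ∎
  where
  open ≡-Reasoning
  c = ballot 0 (suc n)

-- The functional equation C = 1 + x C². In terms of runs: the first push is forced, so
-- `ballot 0 (suc n)` is `ballot 1 n`, whose series is the square.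
C²≗catalan∘suc : C ^ˢ 2 ≗ catalan ∘ suc
C²≗catalan∘suc n = begin
  (C ⊛ (C ⊛ 1ˢ)) n            ≡⟨ ⊛-cong C (ballot 0) (C ⊛ 1ˢ) (ballot 0) catalan≡ballot
                                   (λ m → trans (⊛-identityʳ C m) (catalan≡ballot m)) n ⟩
  (ballot 0 ⊛ ballot 0) n     ≡⟨ ballot-⊛ 0 n ⟩
  ballot 0 (suc n)            ≡⟨ catalan≡ballot (suc n) ⟨
  catalan (suc n)             ∎
  where open ≡-Reasoning

-- Stack runs

private
  variable
    A : Set
    R : A → A → Set
    b c j k l m n t x : ℕ
    U q r v w : List ℕ

allPairs-++⁻ : (xs : List A) {ys : List A} → AllPairs R (xs ++ ys) →
               AllPairs R xs × AllPairs R ys × All (λ x → All (R x) ys) xs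
allPairs-++⁻ []       rs       = [] , rs , []
allPairs-++⁻ (x ∷ xs) (p ∷ rs) with allPairs-++⁻ xs rs
... | rxs , rys , rxys = All.++⁻ˡ xs p ∷ rxs , rys , All.++⁻ʳ xs p ∷ rxys

allPairs-zipAllʳ : ∀ {P : A → Set} {xs} → All P xs → AllPairs R xs →
                   AllPairs (λ x y → P y × R x y) xs
allPairs-zipAllʳ []       []         = []
allPairs-zipAllʳ (_ ∷ ps) (rs ∷ rss) = All.zip (ps , rs) ∷ allPairs-zipAllʳ ps rss

module _ (asym : ∀ {x y : A} → R x y → ¬ R y x) where

  sorted-heads : ∀ {x y xs ys} → All (R x) xs → All (R y) ys → x ∈ y ∷ ys → y ∈ x ∷ xs → x ≡ y
  sorted-heads _  _  (here eq)  _          = eq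
  sorted-heads _  _  (there _)  (here eq)  = sym eq
  sorted-heads px py (there x∈) (there y∈) = contradiction (All.lookup py x∈) (asym (All.lookup px y∈))

  drop-head : ∀ {x y ys} → R y x → x ∈ y ∷ ys → x ∈ ys
  drop-head ryx (here refl) = contradiction ryx (asym ryx)
  drop-head _   (there x∈)  = x∈

  -- Each head precedes the rest of its own list, so two different heads would precede each other.
  -- This later identifies the descents of an opening with a block of consecutive letters.
  sorted-unique : ∀ {xs ys} → AllPairs R xs → AllPairs R ys →
                  (∀ {x} → x ∈ xs → x ∈ ys) → (∀ {x} → x ∈ ys → x ∈ xs) → xs ≡ ys
  sorted-unique []         []         _ _ = refl
  sorted-unique []         (_ ∷ _)    _ g = contradiction (g (here refl)) λ ()
  sorted-unique (_ ∷ _)    []         f _ = contradiction (f (here refl)) λ ()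
  sorted-unique (px ∷ rxs) (py ∷ rys) f g
    with refl ← sorted-heads px py (f (here refl)) (g (here refl)) =
    cong (_ ∷_) (sorted-unique rxs rys
      (λ z∈ → drop-head (All.lookup px z∈) (f (there z∈)))
      (λ z∈ → drop-head (All.lookup py z∈) (g (there z∈))))

-- Avoidance of 132 and the order imposed by the stack

data Avoids132 : List ℕ → Set where
  []  : Avoids132 []
  _∷_ : AllPairs (λ y z → ¬ (x < z × z < y)) w → Avoids132 w → Avoids132 (x ∷ w)

avoids-++⁻ʳ : ∀ v → Avoids132 (v ++ w) → Avoids132 w
avoids-++⁻ʳ []      av       = av
avoids-++⁻ʳ (_ ∷ v) (_ ∷ av) = avoids-++⁻ʳ v av

-- Testing only the later letter z is enough: a y below b is smaller than z anyway.
RisesFrom : ℕ → List ℕ → Set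
RisesFrom b = AllPairs (λ y z → b ≤ z → y < z)

-- Turns a letter c that has already been output into the stack order of the letters from b on. It
-- serves twice: for a push, and with c = b the base of an opening.
avoids⇒rises : c ≤ b → All (c ≢_) w → Unique w →
               AllPairs (λ y z → ¬ (c < z × z < y)) w → RisesFrom b w
avoids⇒rises c≤b c≢ w! a = AllPairs.zipWith
  (λ ((c≢z , y≢z) , ¬p) b≤z → ≤∧≢⇒< (≮⇒≥ λ z<y → ¬p (≤∧≢⇒< (≤-trans c≤b b≤z) c≢z , z<y)) y≢z)
  (allPairs-zipAllʳ c≢ w! , a)

-- If z completes a 132 that starts with x, then it completes one that starts
-- with a or one that starts with the adjacent pair x a.
avoids-∷ : ∀ {a} → All (a ≢_) w → All (λ z → ¬ (x < z × z < a)) w →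
           Avoids132 (a ∷ w) → Avoids132 (x ∷ a ∷ w)
avoids-∷ a≢ adj (as ∷ av) =
  (adj ∷ AllPairs.map
    (λ ((a≢z , ¬p) , ¬q) (x<z , z<y) → ¬q (≤∧≢⇒< (≮⇒≥ λ z<a → ¬p (x<z , z<a)) a≢z , z<y))
    (allPairs-zipAllʳ (All.zip (a≢ , adj)) as))
  ∷ (as ∷ av)

-- The letters b - 1, …, 0 are pushed in this order onto a stack that holds U,
-- top first; w is the output once everything has been popped.
data Run : ℕ → List ℕ → List ℕ → Set where
  done : Run 0 [] []
  push : Run b (b ∷ U) w → Run (suc b) U w
  pop  : Run b U w → Run b (x ∷ U) (x ∷ w)

-- Describes the outputs of runs without mentioning moves: w consists of the letters below b and
-- those of U, each once. `rises` records that the letters from b on are already stacked in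
-- increasing order.
record Completes (b : ℕ) (U w : List ℕ) : Set where
  field
    ∈⁻     : x ∈ w → x < b ⊎ x ∈ U
    ∈⁺     : x < b ⊎ x ∈ U → x ∈ w
    unique : Unique w
    avoids : Avoids132 w
    rises  : RisesFrom b w

open Completes

letters< : Completes n [] v → x ∈ v → x < n
letters< cpl x∈ = Sum.[ id , (λ ()) ]′ (∈⁻ cpl x∈)

module _ (Us : AllPairs _<_ U) (b<U : All (b <_) U) where

  push-sorted : AllPairs _<_ (b ∷ U)
  push-sorted = b<U ∷ Us

  push-bounded : All (b ≤_) (b ∷ U)
  push-bounded = ≤-refl ∷ All.map <⇒≤ b<U

-- A pop puts some x ≥ b in front; a 132 starting with x would contain a descent to a letter above
-- b, against `rises`. For a push, the threshold b of the later state is merely weakened to b + 1.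
run⇒completes : AllPairs _<_ U → All (b ≤_) U → Run b U w → Completes b U w
run⇒completes _ _ done = record
  { ∈⁻ = λ () ; ∈⁺ = λ { (inj₁ ()) ; (inj₂ ()) } ; unique = [] ; avoids = [] ; rises = [] }
run⇒completes {U = U} {w = w} Us b≤U (push {b = b} run) = record
  { ∈⁻     = λ x∈ → to (∈⁻ cpl x∈)
  ; ∈⁺     = λ x∈ → ∈⁺ cpl (from x∈)
  ; unique = unique cpl
  ; avoids = avoids cpl
  ; rises  = AllPairs.map (λ f b<z → f (<⇒≤ b<z)) (rises cpl)
  }
  where
  cpl = run⇒completes (push-sorted Us b≤U) (push-bounded Us b≤U) run
  to : x < b ⊎ x ∈ b ∷ U → x < suc b ⊎ x ∈ U
  to (inj₁ x<b)          = inj₁ (m<n⇒m<1+n x<b)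
  to (inj₂ (here refl))  = inj₁ (n<1+n b)
  to (inj₂ (there x∈))   = inj₂ x∈
  from : x < suc b ⊎ x ∈ U → x < b ⊎ x ∈ b ∷ U
  from (inj₁ x<1+b) = Sum.map₂ here (m<1+n⇒m<n∨m≡n x<1+b)
  from (inj₂ x∈)    = inj₂ (there x∈)
run⇒completes {w = x ∷ w} (x<U ∷ Us) (b≤x ∷ b≤U) (pop {b = b} {U = U} run) = record
  { ∈⁻     = λ { (here refl) → inj₂ (here refl) ; (there y∈) → Sum.map₂ there (∈⁻ cpl y∈) }
  ; ∈⁺     = λ { (inj₁ y<b) → there (∈⁺ cpl (inj₁ y<b))
               ; (inj₂ (here refl)) → here refl
               ; (inj₂ (there y∈)) → there (∈⁺ cpl (inj₂ y∈)) }
  ; unique = All.tabulate (λ y∈ → fresh (∈⁻ cpl y∈)) ∷ unique cpl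
  ; avoids = AllPairs.map (λ f (x<z , z<y) → <-asym z<y (f (≤-trans b≤x (<⇒≤ x<z)))) (rises cpl)
             ∷ avoids cpl
  ; rises  = All.tabulate (λ z∈ b≤z → above b≤z (∈⁻ cpl z∈)) ∷ rises cpl
  }
  where
  cpl = run⇒completes Us b≤U run
  fresh : ∀ {y} → y < b ⊎ y ∈ U → x ≢ y
  fresh (inj₁ y<b) refl = <⇒≱ y<b b≤x
  fresh (inj₂ y∈)  refl = <-irrefl refl (All.lookup x<U y∈)
  above : ∀ {z} → b ≤ z → z < b ⊎ z ∈ U → x < z
  above b≤z (inj₁ z<b) = contradiction b≤z (<⇒≱ z<b)
  above b≤z (inj₂ z∈)  = All.lookup x<U z∈

-- A first letter c ≥ b comes from the stack. Were it below the top x, then x < c would be output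
-- after c, against `rises`.
completes-pop-head : AllPairs _<_ (x ∷ U) → All (b ≤_) (x ∷ U) →
                     Completes b (x ∷ U) (c ∷ w) → b ≤ c → c ≡ x
completes-pop-head (x<U ∷ _) (b≤x ∷ _) cpl b≤c with ∈⁻ cpl (here refl)
... | inj₁ c<b         = contradiction b≤c (<⇒≱ c<b)
... | inj₂ (here c≡x)  = c≡x
... | inj₂ (there c∈U) with ∈⁺ cpl (inj₂ (here refl))
...   | here x≡c  = sym x≡c
...   | there x∈w with r ∷ _ ← rises cpl =
  contradiction (All.lookup r x∈w b≤x) (<-asym (All.lookup x<U c∈U))

completes-pop : AllPairs _<_ (x ∷ U) → All (b ≤_) (x ∷ U) →
                Completes b (x ∷ U) (x ∷ w) → Completes b U w
completes-pop (x<U ∷ _) (b≤x ∷ _) cpl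
  with x≢ ∷ u ← unique cpl | _ ∷ av ← avoids cpl | _ ∷ rs ← rises cpl = record
  { ∈⁻ = λ y∈ → Sum.map₂ (λ { (here refl) → contradiction refl (All.lookup x≢ y∈)
                            ; (there y∈U) → y∈U }) (∈⁻ cpl (there y∈))
  ; ∈⁺ = λ { (inj₁ y<b) → case₁ y<b (∈⁺ cpl (inj₁ y<b))
           ; (inj₂ y∈) → case₂ (All.lookup x<U y∈) (∈⁺ cpl (inj₂ (there y∈))) }
  ; unique = u
  ; avoids = av
  ; rises  = rs
  }
  where
  case₁ : ∀ {y} → y < _ → y ∈ _ ∷ _ → y ∈ _
  case₁ y<b (here refl) = contradiction b≤x (<⇒≱ y<b)
  case₁ _   (there y∈)  = y∈
  case₂ : ∀ {y} → _ < y → y ∈ _ ∷ _ → y ∈ _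
  case₂ x<y (here refl) = contradiction x<y (<-irrefl refl)
  case₂ _   (there y∈)  = y∈

-- A first letter c ≤ b followed by a descent y > z with b ≤ z would be a 132,
-- so the letter b may be put on the stack.
completes-push : Completes (suc b) U (c ∷ w) → c ≤ b → Completes b (b ∷ U) (c ∷ w)
completes-push cpl c≤b
  with c≢ ∷ u ← unique cpl | a ∷ _ ← avoids cpl = record
  { ∈⁻ = λ x∈ → to (∈⁻ cpl x∈)
  ; ∈⁺ = λ { (inj₁ x<b) → ∈⁺ cpl (inj₁ (m<n⇒m<1+n x<b))
           ; (inj₂ (here refl)) → ∈⁺ cpl (inj₁ (n<1+n _))
           ; (inj₂ (there x∈)) → ∈⁺ cpl (inj₂ x∈) }
  ; unique = unique cpl
  ; avoids = avoids cpl
  ; rises  = All.map (λ c≢z b≤z → ≤∧≢⇒< (≤-trans c≤b b≤z) c≢z) c≢ ∷ avoids⇒rises c≤b c≢ u a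
  }
  where
  to : x < suc b ⊎ x ∈ U → x < b ⊎ x ∈ b ∷ U
  to (inj₁ x<1+b) = Sum.map₂ here (m<1+n⇒m<n∨m≡n x<1+b)
  to (inj₂ x∈)    = inj₂ (there x∈)

run-pop : AllPairs _<_ (x ∷ U) → All (b ≤_) (x ∷ U) → Completes b (x ∷ U) (c ∷ w) → b ≤ c →
          (Completes b U w → Run b U w) → Run b (x ∷ U) (c ∷ w)
run-pop Us b≤U cpl b≤c rec with refl ← completes-pop-head Us b≤U cpl b≤c =
  pop (rec (completes-pop Us b≤U cpl))

-- The first letter of w forces the move: if it is not yet on the stack, a push is due; otherwise it
-- is the top and is popped. Pushes decrease b, pops shorten w.
completes⇒run : ∀ b U w → AllPairs _<_ U → All (b ≤_) U → Completes b U w → Run b U w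
completes⇒run zero    []      []      _ _ _   = done
completes⇒run zero    []      (c ∷ w) _ _ cpl = contradiction (∈⁻ cpl (here refl)) λ { (inj₁ ()) ; (inj₂ ()) }
completes⇒run b       (x ∷ U) []      _ _ cpl = contradiction (∈⁺ cpl (inj₂ (here refl))) λ ()
completes⇒run (suc b) []      []      _ _ cpl = contradiction (∈⁺ cpl (inj₁ (n<1+n b))) λ ()
completes⇒run zero (x ∷ U) (c ∷ w) Us b≤U cpl =
  run-pop Us b≤U cpl z≤n (completes⇒run zero U w (AllPairs.tail Us) (All.tail b≤U))
completes⇒run (suc b) [] (c ∷ w) Us b≤U cpl = Sum.[
  (λ c<1+b → push (completes⇒run b [ b ] (c ∷ w) (push-sorted Us b≤U) (push-bounded Us b≤U)
    (completes-push cpl (s≤s⁻¹ c<1+b)))) ,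
  (λ ()) ]′ (∈⁻ cpl (here refl))
completes⇒run (suc b) (x ∷ U) (c ∷ w) Us b≤U cpl = Sum.[
  (λ c<1+b → push (completes⇒run b (b ∷ x ∷ U) (c ∷ w) (push-sorted Us b≤U) (push-bounded Us b≤U)
    (completes-push cpl (s≤s⁻¹ c<1+b)))) ,
  (λ b<c → run-pop Us b≤U cpl b<c (completes⇒run (suc b) U w (AllPairs.tail Us) (All.tail b≤U)))
  ]′ (<-≤-connex c (suc b))

run-length : Run b U w → length w ≡ b + length U
run-length done = refl
run-length (push {b = b} {U = U} run) = trans (run-length run) (+-suc b (length U))
run-length (pop {b = b} {U = U} run) = trans (cong suc (run-length run)) (sym (+-suc b (length U)))

-- Enumerating the outputs of runs

outputs : ℕ → List ℕ → List (List ℕ)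
outputs zero    []      = [ [] ]
outputs zero    (x ∷ U) = map (x ∷_) (outputs zero U)
outputs (suc b) []      = outputs b [ b ]
outputs (suc b) (x ∷ U) = map (x ∷_) (outputs (suc b) U) ++ outputs b (b ∷ x ∷ U)

length-outputs : ∀ b U → length (outputs b U) ≡ ballot (length U) b
length-outputs zero    []      = refl
length-outputs zero    (x ∷ U) = trans (length-map (x ∷_) (outputs zero U)) (length-outputs zero U)
length-outputs (suc b) []      = length-outputs b [ b ]
length-outputs (suc b) (x ∷ U) = trans (length-++ (map (x ∷_) (outputs (suc b) U)))
  (cong₂ _+_ (trans (length-map (x ∷_) (outputs (suc b) U)) (length-outputs (suc b) U))
             (length-outputs b (b ∷ x ∷ U)))

run⇒∈outputs : Run b U w → w ∈ outputs b U
run⇒∈outputs done = here refl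
run⇒∈outputs {U = []}    (push run) = run⇒∈outputs run
run⇒∈outputs {U = x ∷ U} (push {b = b} run) = ∈-++⁺ʳ (map (x ∷_) (outputs (suc b) U)) (run⇒∈outputs run)
run⇒∈outputs {b = zero}  (pop run) = ∈-map⁺ (_ ∷_) (run⇒∈outputs run)
run⇒∈outputs {b = suc b} (pop run) = ∈-++⁺ˡ (∈-map⁺ (_ ∷_) (run⇒∈outputs run))

∈outputs⇒run : ∀ b U → w ∈ outputs b U → Run b U w
∈outputs⇒run zero    []      (here refl) = done
∈outputs⇒run zero    (x ∷ U) w∈ with _ , v∈ , refl ← ∈-map⁻ (x ∷_) w∈ = pop (∈outputs⇒run zero U v∈)
∈outputs⇒run (suc b) []      w∈ = push (∈outputs⇒run b [ b ] w∈)
∈outputs⇒run (suc b) (x ∷ U) w∈ with ∈-++⁻ (map (x ∷_) (outputs (suc b) U)) w∈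
... | inj₁ w∈ˡ with _ , v∈ , refl ← ∈-map⁻ (x ∷_) w∈ˡ = pop (∈outputs⇒run (suc b) U v∈)
... | inj₂ w∈ʳ = push (∈outputs⇒run b (b ∷ x ∷ U) w∈ʳ)

outputs-unique : ∀ b U → AllPairs _<_ U → All (b ≤_) U → Unique (outputs b U)
outputs-unique zero    []      _  _   = [] ∷ []
outputs-unique zero    (x ∷ U) Us b≤U =
  Unique.map⁺ ∷-injectiveʳ (outputs-unique zero U (AllPairs.tail Us) (All.tail b≤U))
outputs-unique (suc b) []      Us b≤U = outputs-unique b [ b ] (push-sorted Us b≤U) (push-bounded Us b≤U)
outputs-unique (suc b) (x ∷ U) Us b≤U = Unique.++⁺
  (Unique.map⁺ ∷-injectiveʳ (outputs-unique (suc b) U (AllPairs.tail Us) (All.tail b≤U)))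
  (outputs-unique b (b ∷ x ∷ U) Us′ b≤U′)
  λ (v∈ˡ , v∈ʳ) → disjoint v∈ˡ v∈ʳ
  where
  Us′  = push-sorted Us b≤U
  b≤U′ = push-bounded Us b≤U
  -- After b has been pushed above x, it also leaves the stack before x.
  disjoint : v ∈ map (x ∷_) (outputs (suc b) U) → ¬ (v ∈ outputs b (b ∷ x ∷ U))
  disjoint v∈ˡ v∈ʳ with _ , _ , refl ← ∈-map⁻ (x ∷_) v∈ˡ
    with cpl ← run⇒completes Us′ b≤U′ (∈outputs⇒run b (b ∷ x ∷ U) v∈ʳ)
    with ∈⁺ cpl (inj₂ (here refl))
  ... | here refl = <-irrefl refl (All.head b≤U)
  ... | there b∈  with r ∷ _ ← rises cpl = <-asym (All.head b≤U) (All.lookup r b∈ ≤-refl)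

-- Intervals of letters and the openings built from them

∈-iterate-suc⁻ : ∀ l → x ∈ iterate suc m l → m ≤ x × x < m + l
∈-iterate-suc⁻ {m = m} (suc l) (here refl) = ≤-refl , m<m+n m z<s
∈-iterate-suc⁻ {x = x} {m} (suc l) (there x∈) with m<x , x<m+l ← ∈-iterate-suc⁻ l x∈ =
  <⇒≤ m<x , subst (x <_) (sym (+-suc m l)) x<m+l

∈-iterate-suc⁺ : ∀ l → m ≤ x → x < m + l → x ∈ iterate suc m l
∈-iterate-suc⁺ {m} {x} zero m≤x x<m = contradiction m≤x (<⇒≱ (subst (x <_) (+-identityʳ m) x<m))
∈-iterate-suc⁺ {m} {x} (suc l) m≤x x<m+l with m≤n⇒m<n∨m≡n m≤x
... | inj₁ m<x = there (∈-iterate-suc⁺ l m<x (subst (x <_) (+-suc m l) x<m+l))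
... | inj₂ m≡x = here (sym m≡x)

iterate-suc-sorted : ∀ m l → AllPairs _<_ (iterate suc m l)
iterate-suc-sorted m zero    = []
iterate-suc-sorted m (suc l) =
  All.tabulate (λ x∈ → proj₁ (∈-iterate-suc⁻ l x∈)) ∷ iterate-suc-sorted (suc m) l

length-iterate-suc : ∀ m l → length (iterate suc m l) ≡ l
length-iterate-suc m zero    = refl
length-iterate-suc m (suc l) = cong suc (length-iterate-suc (suc m) l)

-- Here k counts the descending letters only: the pattern has length k + 1.
DescentsThenMax : ℕ → List ℕ → Set
DescentsThenMax k v = ∃[ q ] ∃[ t ] ∃[ r ]
  v ≡ q ++ t ∷ r × length q ≡ k × AllPairs _>_ q × All (_< t) q

-- Letters count from 0, so the base m is the least letter of the block m+k-1, ..., m and also the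
-- number of letters below it.
opening : ℕ → ℕ → List ℕ → List ℕ
opening k m w = applyDownFrom (m +_) k ++ (m + k) ∷ w

opening-base-injective : ∀ k {m m′ w w′} → opening k m w ≡ opening k m′ w′ → m ≡ m′
opening-base-injective zero    {m} {m′} eq = +-cancelʳ-≡ 0 m m′ (∷-injectiveˡ eq)
opening-base-injective (suc k) {m} {m′} eq = +-cancelʳ-≡ k m m′ (∷-injectiveˡ eq)

opening-injective : ∀ k {m m′ w w′} → opening k m w ≡ opening k m′ w′ → m ≡ m′ × w ≡ w′
opening-injective k {m} eq with refl ← opening-base-injective k eq =
  refl , ∷-injectiveʳ (++-cancelˡ (applyDownFrom (m +_) k) _ _ eq)

-- The stack, top first, once the opening is out: the l letters above m + k.
remaining : ℕ → ℕ → ℕ → List ℕ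
remaining k m l = iterate suc (suc (m + k)) l

-- The words whose opening has base at most m, where l letters exceed the
-- opening of base m.
openings : ℕ → ℕ → ℕ → List (List ℕ)
openings k zero    l = map (opening k 0) (outputs 0 (remaining k 0 l))
openings k (suc m) l =
  map (opening k (suc m)) (outputs (suc m) (remaining k (suc m) l)) ++ openings k m (suc l)

-- The largest base contributes the pop term of the `ballot` recurrence, and all smaller bases
-- together its push term.
length-openings : ∀ k m l → length (openings k m l) ≡ ballot (suc l) m
length-openings k zero l = begin
  length (openings k 0 l)                        ≡⟨ length-map (opening k 0) (outputs 0 (remaining k 0 l)) ⟩
  length (outputs 0 (remaining k 0 l))           ≡⟨ length-outputs 0 (remaining k 0 l) ⟩
  1                                              ∎
  where open ≡-Reasoning
length-openings k (suc m) l = begin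
  length (openings k (suc m) l)
    ≡⟨ length-++ (map (opening k (suc m)) (outputs (suc m) rest)) ⟩
  length (map (opening k (suc m)) (outputs (suc m) rest)) + length (openings k m (suc l))
    ≡⟨ cong₂ _+_ (length-map (opening k (suc m)) (outputs (suc m) rest)) (length-openings k m (suc l)) ⟩
  length (outputs (suc m) rest) + ballot (2 + l) m
    ≡⟨ cong (_+ ballot (2 + l) m) (length-outputs (suc m) rest) ⟩
  ballot (length rest) (suc m) + ballot (2 + l) m
    ≡⟨ cong (λ d → ballot d (suc m) + ballot (2 + l) m) (length-iterate-suc (suc (suc m + k)) l) ⟩
  ballot l (suc m) + ballot (2 + l) m ∎
  where
  open ≡-Reasoning
  rest = remaining k (suc m) l

∈openings⁻ : ∀ k n l → v ∈ openings k n l →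
             ∃[ m ] ∃[ j ] ∃[ w ] m + j ≡ n × v ≡ opening k m w × Run m (remaining k m (j + l)) w
∈openings⁻ k zero l v∈ with w , w∈ , eq ← ∈-map⁻ (opening k 0) v∈ =
  0 , 0 , w , refl , eq , ∈outputs⇒run 0 (remaining k 0 l) w∈
∈openings⁻ k (suc n) l v∈ with ∈-++⁻ (map (opening k (suc n)) (outputs (suc n) (remaining k (suc n) l))) v∈
... | inj₁ v∈ˡ with w , w∈ , eq ← ∈-map⁻ (opening k (suc n)) v∈ˡ =
  suc n , 0 , w , +-identityʳ (suc n) , eq , ∈outputs⇒run (suc n) (remaining k (suc n) l) w∈
... | inj₂ v∈ʳ with m , j , w , m+j≡n , eq , run ← ∈openings⁻ k n (suc l) v∈ʳ =
  m , suc j , w , trans (+-suc m j) (cong suc m+j≡n) , eq ,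
  subst (λ i → Run m (remaining k m i) w) (+-suc j l) run

∈openings⁺ : ∀ k m j l → Run m (remaining k m (j + l)) w → opening k m w ∈ openings k (m + j) l
∈openings⁺ k zero    zero    l run = ∈-map⁺ (opening k 0) (run⇒∈outputs run)
∈openings⁺ k (suc m) zero    l run rewrite +-identityʳ m =
  ∈-++⁺ˡ (∈-map⁺ (opening k (suc m)) (run⇒∈outputs run))
∈openings⁺ {w = w} k m (suc j) l run rewrite +-suc m j =
  ∈-++⁺ʳ (map (opening k (suc (m + j))) (outputs (suc (m + j)) (remaining k (suc (m + j)) l)))
    (∈openings⁺ k m j (suc l) (subst (λ i → Run m (remaining k m i) w) (sym (+-suc j l)) run))

remaining-sorted : ∀ k m l → AllPairs _<_ (remaining k m l)
remaining-sorted k m l = iterate-suc-sorted (suc (m + k)) l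

remaining-bounded : ∀ k m l → All (m ≤_) (remaining k m l)
remaining-bounded k m l =
  All.tabulate λ x∈ → ≤-trans (m≤m+n m k) (<⇒≤ (proj₁ (∈-iterate-suc⁻ l x∈)))

openings-unique : ∀ k n l → Unique (openings k n l)
openings-unique k zero l =
  Unique.map⁺ (λ eq → proj₂ (opening-injective k eq))
    (outputs-unique 0 _ (remaining-sorted k 0 l) (remaining-bounded k 0 l))
openings-unique k (suc n) l = Unique.++⁺
  (Unique.map⁺ (λ eq → proj₂ (opening-injective k eq))
    (outputs-unique (suc n) _ (remaining-sorted k (suc n) l) (remaining-bounded k (suc n) l)))
  (openings-unique k n (suc l))
  λ (v∈ˡ , v∈ʳ) → disjoint v∈ˡ v∈ʳ
  where
  disjoint : v ∈ map (opening k (suc n)) (outputs (suc n) (remaining k (suc n) l)) →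
             ¬ (v ∈ openings k n (suc l))
  disjoint v∈ˡ v∈ʳ with _ , _ , eq ← ∈-map⁻ (opening k (suc n)) v∈ˡ
    with m , j , _ , m+j≡n , eq′ , _ ← ∈openings⁻ k n (suc l) v∈ʳ
    with refl , _ ← opening-injective k (trans (sym eq) eq′) =
    contradiction (subst (suc n ≤_) m+j≡n (m≤m+n (suc n) j)) (<-irrefl refl)

+-right-comm : ∀ m k j → m + k + j ≡ m + j + k
+-right-comm m k j = trans (+-assoc m k j) (trans (cong (m +_) (+-comm k j)) (sym (+-assoc m j k)))

-- Each descending letter is popped as soon as it is pushed, so U stays untouched.
run-descents : ∀ m i → Run m U w → Run (m + i) U (applyDownFrom (m +_) i ++ w)
run-descents {U} {w} m zero    run = subst (λ b → Run b U w) (sym (+-identityʳ m)) run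
run-descents {U} {w} m (suc i) run =
  subst (λ b → Run b U (applyDownFrom (m +_) (suc i) ++ w)) (sym (+-suc m i))
    (push (pop (run-descents m i run)))

run-pushes : ∀ b j → Run b (iterate suc b j) w → Run (b + j) [] w
run-pushes {w} b zero    run = subst (λ b → Run b [] w) (sym (+-identityʳ b)) run
run-pushes {w} b (suc j) run = subst (λ b → Run b [] w) (sym (+-suc b j)) (run-pushes (suc b) j (push run))

∈openings⇒completes : ∀ k n → v ∈ openings k n 0 → Completes (suc (n + k)) [] v × DescentsThenMax k v
∈openings⇒completes {v} k n v∈
  with m , j , w , refl , refl , run ← ∈openings⁻ k n 0 v∈ =
  run⇒completes [] [] (subst (λ b → Run b [] v) total run-all) ,
  applyDownFrom (m +_) k , m + k , w , refl , length-applyDownFrom (m +_) k ,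
  AllPairs.applyDownFrom⁺₁ (m +_) k (λ j<i _ → +-monoʳ-< m j<i) ,
  All.applyDownFrom⁺₁ (m +_) k (λ i<k → +-monoʳ-< m i<k)
  where
  -- Push everything down to m + k, push and pop the k letters m+k-1, ..., m one by one, then pop m
  -- + k.
  run-all : Run (m + k + suc j) [] v
  run-all = run-pushes (m + k) (suc j) (run-descents m k
    (pop (subst (λ i → Run m (remaining k m i) w) (+-identityʳ j) run)))
  total : m + k + suc j ≡ suc (m + j + k)
  total = trans (+-suc (m + k) j) (cong suc (+-right-comm m k j))

-- The base is the last letter of q, or t if q is empty; no letter between the
-- base and t is left for the rest r.
opening-base : ∀ q t r → Completes n [] (q ++ t ∷ r) → AllPairs _>_ q → All (_< t) q →
  ∃[ m ] m ≤ t × All (m ≤_) q × (∀ {x} → m ≤ x → x < t → x ∈ q) ×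
         All (m ≢_) r × AllPairs (λ y z → ¬ (m < z × z < y)) r
opening-base q t r cpl q> q<t with initLast q
... | [] with t≢ ∷ _ ← unique cpl | a ∷ _ ← avoids cpl =
  t , ≤-refl , [] , (λ t≤x x<t → contradiction t≤x (<⇒≱ x<t)) , t≢ , a
... | q′ ∷ʳ′ m
  with _ , (_ ∷ m≢) ∷ _ , _ ← allPairs-++⁻ q′ (subst Unique (++-assoc q′ [ m ] (t ∷ r)) (unique cpl))
  with (t-first ∷ a) ∷ _ ← avoids-++⁻ʳ q′ (subst Avoids132 (++-assoc q′ [ m ] (t ∷ r)) (avoids cpl)) =
  m , <⇒≤ m<t ,
  All.++⁺ (All.map (λ { (m<x ∷ []) → <⇒≤ m<x }) (proj₂ (proj₂ (allPairs-++⁻ q′ q>)))) (≤-refl ∷ []) ,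
  between , m≢ , a
  where
  m<t : m < t
  m<t = All.lookup q<t (∈-++⁺ʳ q′ (here refl))
  t<n : t < _
  t<n = letters< cpl (∈-++⁺ʳ (q′ ∷ʳ m) (here refl))
  between : ∀ {x} → m ≤ x → x < t → x ∈ q′ ∷ʳ m
  between {x} m≤x x<t with m≤n⇒m<n∨m≡n m≤x
  ... | inj₂ refl = ∈-++⁺ʳ q′ (here refl)
  ... | inj₁ m<x with ∈-++⁻ (q′ ∷ʳ m) (∈⁺ cpl {x} (inj₁ (<-trans x<t t<n)))
  ...   | inj₁ x∈q          = x∈q
  ...   | inj₂ (here refl)  = contradiction x<t (<-irrefl refl)
  ...   | inj₂ (there x∈r)  = contradiction (m<x , x<t) (All.lookup t-first x∈r)

descents-between : AllPairs _>_ q → All (m ≤_) q → All (_< m + k) q →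
                   (∀ {x} → m ≤ x → x < m + k → x ∈ q) → q ≡ applyDownFrom (m +_) k
descents-between {q} {m} {k} q> m≤q q<m+k between = sorted-unique <-asym q>
  (AllPairs.applyDownFrom⁺₁ (m +_) k (λ j<i _ → +-monoʳ-< m j<i))
  (λ x∈ → to (All.lookup m≤q x∈) (All.lookup q<m+k x∈)) from
  where
  to : m ≤ x → x < m + k → x ∈ applyDownFrom (m +_) k
  to m≤x x<m+k with i , refl ← m≤n⇒∃[o]m+o≡n m≤x =
    ∈-applyDownFrom⁺ (m +_) (+-cancelˡ-< m i k x<m+k)
  from : x ∈ applyDownFrom (m +_) k → x ∈ q
  from x∈ with i , i<k , refl ← ∈-applyDownFrom⁻ (m +_) x∈ =
    between (m≤m+n m i) (+-monoʳ-< m i<k)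

-- Everything from m up to t - 1 is in q, so r holds exactly the letters below m and those above t.
-- The base m precedes r, and this yields `rises`.
completes-rest : ∀ q → Completes (suc (t + j)) [] (q ++ t ∷ r) → All (_< t) q →
  m ≤ t → All (m ≤_) q → (∀ {x} → m ≤ x → x < t → x ∈ q) →
  All (m ≢_) r → AllPairs (λ y z → ¬ (m < z × z < y)) r →
  Completes m (iterate suc (suc t) j) r
completes-rest {t} {j} {r} {m} q cpl q<t m≤t m≤q between m≢r m-avoids
  with _ , t≢r ∷ r! , q≢ ← allPairs-++⁻ q (unique cpl)
  with _ ∷ r-avoids ← avoids-++⁻ʳ q (avoids cpl) = record
  { ∈⁻     = to
  ; ∈⁺     = λ { (inj₁ x<m) → from (inj₁ x<m) (∈-++⁻ q (∈⁺ cpl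
                               (inj₁ (<-≤-trans x<m (≤-trans m≤t (<⇒≤ (s≤s (m≤m+n t j))))))))
               ; (inj₂ x∈) → let t<x , x<n = ∈-iterate-suc⁻ j x∈ in
                             from (inj₂ t<x) (∈-++⁻ q (∈⁺ cpl (inj₁ x<n))) }
  ; unique = r!
  ; avoids = r-avoids
  ; rises  = avoids⇒rises ≤-refl m≢r r! m-avoids
  }
  where
  to : x ∈ r → x < m ⊎ x ∈ iterate suc (suc t) j
  to {x} x∈ with <-cmp x t | x <? m
  ... | _            | yes x<m = inj₁ x<m
  ... | tri< x<t _ _ | no  x≮m =
    contradiction refl (All.lookup (All.lookup q≢ (between (≮⇒≥ x≮m) x<t)) (there x∈))
  ... | tri≈ _ refl _ | no _   = contradiction refl (All.lookup t≢r x∈)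
  ... | tri> _ _ t<x | no _    =
    inj₂ (∈-iterate-suc⁺ j t<x (letters< cpl (∈-++⁺ʳ q (there x∈))))
  from : x < m ⊎ t < x → x ∈ q ⊎ x ∈ t ∷ r → x ∈ r
  from (inj₁ x<m) (inj₁ x∈q)         = contradiction (All.lookup m≤q x∈q) (<⇒≱ x<m)
  from (inj₂ t<x) (inj₁ x∈q)         = contradiction (All.lookup q<t x∈q) (<-asym t<x)
  from (inj₁ x<m) (inj₂ (here refl)) = contradiction m≤t (<⇒≱ x<m)
  from (inj₂ t<x) (inj₂ (here refl)) = contradiction t<x (<-irrefl refl)
  from _          (inj₂ (there x∈))  = x∈

completes⇒∈openings : ∀ k n → Completes (suc (n + k)) [] v → DescentsThenMax k v → v ∈ openings k n 0
completes⇒∈openings {v} k n cpl (q , t , r , refl , |q|≡k , q> , q<t)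
  with m , m≤t , m≤q , between , m≢r , m-avoids ← opening-base q t r cpl q> q<t
  -- The gap e = t - m equals the length of q, hence k; below, j counts the letters above t, so that
  -- n = m + j.
  with e , refl ← m≤n⇒∃[o]m+o≡n m≤t
  with refl ← descents-between q> m≤q q<t between
  with refl ← trans (sym (length-applyDownFrom (m +_) e)) |q|≡k
  with j , eq ← m≤n⇒∃[o]m+o≡n (letters< cpl (∈-++⁺ʳ (applyDownFrom (m +_) k) (here refl)))
  with refl ← +-cancelʳ-≡ k (m + j) n (suc-injective (trans (sym (cong suc (+-right-comm m k j))) eq)) =
  ∈openings⁺ k m j 0 (subst (λ i → Run m (remaining k m i) r) (sym (+-identityʳ j))
    (completes⇒run m (remaining k m j) r (remaining-sorted k m j) (remaining-bounded k m j)
      (completes-rest _ (subst (λ N → Completes N [] v) (sym (cong suc (+-right-comm m k j))) cpl)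
        q<t m≤t m≤q between m≢r m-avoids)))

-- Permutations as words over ℕ

module _ {R : A → A → Set} where

  allPairs-toList⁺ : ∀ {xs : Vec A n} → VecAllPairs.AllPairs R xs → AllPairs R (Vec.toList xs)
  allPairs-toList⁺ []       = []
  allPairs-toList⁺ (p ∷ rs) = VecAll.toList⁺ p ∷ allPairs-toList⁺ rs

  allPairs-toList⁻ : ∀ {xs : Vec A n} → AllPairs R (Vec.toList xs) → VecAllPairs.AllPairs R xs
  allPairs-toList⁻ {xs = []}    []       = []
  allPairs-toList⁻ {xs = _ ∷ _} (p ∷ rs) = VecAll.toList⁻ p ∷ allPairs-toList⁻ rs

  allPairs-lookup⁺ : ∀ {xs : Vec A n} → VecAllPairs.AllPairs R xs →
                     ∀ {i j} → i Fin.< j → R (lookup xs i) (lookup xs j)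
  allPairs-lookup⁺ (p ∷ _)  {Fin.zero}  {Fin.suc j} _         = VecAll.lookup⁺ p j
  allPairs-lookup⁺ (_ ∷ rs) {Fin.suc i} {Fin.suc j} (s≤s i<j) = allPairs-lookup⁺ rs i<j

  allPairs-lookup⁻ : ∀ {xs : Vec A n} → (∀ {i j} → i Fin.< j → R (lookup xs i) (lookup xs j)) →
                     VecAllPairs.AllPairs R xs
  allPairs-lookup⁻ {xs = []}    f = []
  allPairs-lookup⁻ {xs = _ ∷ _} f =
    VecAll.lookup⁻ (λ j → f {Fin.zero} {Fin.suc j} z<s) ∷ allPairs-lookup⁻ (f ∘ s≤s)

-- Over ℕ a suffix of a permutation keeps its letters, with no relabelling and no alphabet in the
-- type.
word : Vec (Fin n) l → List ℕ
word π = map toℕ (Vec.toList π)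

word-injective : {π ρ : Vec (Fin n) l} → word π ≡ word ρ → π ≡ ρ
word-injective {π = []}    {[]}    _  = refl
word-injective {π = _ ∷ _} {_ ∷ _} eq =
  cong₂ _∷_ (Fin.toℕ-injective (∷-injectiveˡ eq)) (word-injective (∷-injectiveʳ eq))

length-word : (π : Vec (Fin n) l) → length (word π) ≡ l
length-word π = trans (length-map toℕ (Vec.toList π)) (Vec.length-toList π)

word-∷ʳ : (π : Vec (Fin n) l) (x : Fin n) → word (π Vec.∷ʳ x) ≡ word π ++ [ toℕ x ]
word-∷ʳ π x = trans (cong (map toℕ) (Vec.toList-∷ʳ x π)) (map-++ toℕ (Vec.toList π) _)

word-truncate : ∀ (k≤l : k ≤ l) (π : Vec (Fin n) l) → ∃[ r ] word π ≡ word (truncate k≤l π) ++ r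
word-truncate z≤n       π       = word π , refl
word-truncate (s≤s k≤l) (x ∷ π) with r , eq ← word-truncate k≤l π = r , cong (toℕ x ∷_) eq

word-surjective : All (_< n) v → length v ≡ l → Σ[ π ∈ Vec (Fin n) l ] word π ≡ v
word-surjective []         refl = [] , refl
word-surjective (x<n ∷ v<) refl with π , eq ← word-surjective v< refl =
  fromℕ< x<n ∷ π , cong₂ _∷_ (Fin.toℕ-fromℕ< x<n) eq

letter< : (π : Vec (Fin n) l) → x ∈ word π → x < n
letter< π x∈ with i , _ , refl ← ∈-map⁻ toℕ x∈ = Fin.toℕ<n i

word-unique⁺ : {π : Vec (Fin n) l} → VecAllPairs.AllPairs _≢_ π → Unique (word π)
word-unique⁺ π! = Unique.map⁺ Fin.toℕ-injective (allPairs-toList⁺ π!)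

word-unique⁻ : {π : Vec (Fin n) l} → Unique (word π) → VecAllPairs.AllPairs _≢_ π
word-unique⁻ w! = allPairs-toList⁻ (AllPairs.map (λ ne eq → ne (cong toℕ eq)) (AllPairs.map⁻ w!))

unique-short : (ys : Vec (Fin n) (suc n)) → ¬ VecAllPairs.AllPairs _≢_ ys
unique-short {n} ys ys! with i , j , i<j , eq ← Fin.pigeonhole (n<1+n n) (lookup ys) =
  Fin.<-irrefl (VecUnique.lookup-injective ys! i j eq) i<j

-- If x were missing, putting it in front would give n + 1 distinct letters of `Fin n`.
permutation-surjective : {π : Vec (Fin n) n} → IsPermutation π → x < n → x ∈ word π
permutation-surjective {π = π} π! x<n with VecMembership._∈?_ Fin._≟_ (fromℕ< x<n) π
... | yes y∈π = subst (_∈ word π) (Fin.toℕ-fromℕ< x<n) (∈-map⁺ toℕ (VecMembership.∈-toList⁺ y∈π))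
... | no  y∉π = contradiction (VecAll.lookup⁻ fresh ∷ π!) (unique-short (fromℕ< x<n ∷ π))
  where
  fresh : ∀ i → fromℕ< x<n ≢ lookup π i
  fresh i eq = y∉π (subst (VecMembership._∈ π) (sym eq) (VecMembership.∈-lookup i π))

-- If τ has no repeated letters, one direction suffices: trichotomy in τ gives the converse.
orderIsomorphic-intro : ∀ {a b k} (σ : Vec (Fin a) k) (τ : Vec (Fin b) k) →
  (∀ i j → lookup τ i Fin.< lookup τ j → lookup σ i Fin.< lookup σ j) →
  (∀ i j → lookup τ i ≡ lookup τ j → i ≡ j) → OrderIsomorphic σ τ
orderIsomorphic-intro σ τ mono inj i j = mk⇔ reflect (mono i j)
  where
  reflect : lookup σ i Fin.< lookup σ j → lookup τ i Fin.< lookup τ j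
  reflect σi<σj with Fin.<-cmp (lookup τ i) (lookup τ j)
  ... | tri< τi<τj _ _ = τi<τj
  ... | tri≈ _ eq _ with refl ← inj i j eq = contradiction σi<σj (<-irrefl refl)
  ... | tri> _ _ τj<τi = contradiction σi<σj (<-asym (mono j i τj<τi))

-- The pattern 13-2

iso132⁺ : (x y z : Fin n) → x Fin.< z → z Fin.< y → OrderIsomorphic (x ∷ y ∷ z ∷ []) p132
iso132⁺ x y z x<z z<y = orderIsomorphic-intro (x ∷ y ∷ z ∷ []) p132 mono inj
  where
  mono : ∀ i j → lookup p132 i Fin.< lookup p132 j →
         lookup (x ∷ y ∷ z ∷ []) i Fin.< lookup (x ∷ y ∷ z ∷ []) j
  mono 0F 1F _ = <-trans x<z z<y
  mono 0F 2F _ = x<z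
  mono 2F 1F _ = z<y
  mono 0F 0F ()
  mono 1F 0F ()
  mono 1F 1F (s≤s (s≤s ()))
  mono 1F 2F (s≤s ())
  mono 2F 0F ()
  mono 2F 2F (s≤s ())
  inj : ∀ i j → lookup p132 i ≡ lookup p132 j → i ≡ j
  inj 0F 0F _ = refl
  inj 1F 1F _ = refl
  inj 2F 2F _ = refl
  inj 0F 1F ()
  inj 0F 2F ()
  inj 1F 0F ()
  inj 1F 2F ()
  inj 2F 0F ()
  inj 2F 1F ()

iso132⁻ : (x y z : Fin n) → OrderIsomorphic (x ∷ y ∷ z ∷ []) p132 → x Fin.< z × z Fin.< y
iso132⁻ x y z iso = Equivalence.from (iso 0F 2F) z<s , Equivalence.from (iso 2F 1F) (s≤s z<s)

-- Length and alphabet are separated so that the condition passes to tails.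
AdjacentFree : Vec (Fin n) l → Set
AdjacentFree π = ∀ i i′ j → toℕ i′ ≡ suc (toℕ i) → i′ Fin.< j →
  ¬ (lookup π i Fin.< lookup π j × lookup π j Fin.< lookup π i′)

avoids13-2⇒adjacentFree : {π : Vec (Fin n) n} → Avoids13-2 π → AdjacentFree π
avoids13-2⇒adjacentFree av i i′ j eq i′<j (πi<πj , πj<πi′) =
  av (i , i′ , j , eq , i′<j , iso132⁺ _ _ _ πi<πj πj<πi′)

adjacentFree⇒avoids13-2 : {π : Vec (Fin n) n} → AdjacentFree π → Avoids13-2 π
adjacentFree⇒avoids13-2 free (i , i′ , j , eq , i′<j , iso) = free i i′ j eq i′<j (iso132⁻ _ _ _ iso)

-- A new front letter forms just one new adjacent pair, and `avoids-∷` reduces every new 132 to that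
-- pair or to one already excluded.
adjacentFree⇒avoids132 : (π : Vec (Fin n) l) → Unique (word π) → AdjacentFree π → Avoids132 (word π)
adjacentFree⇒avoids132 []          _              _    = []
adjacentFree⇒avoids132 (_ ∷ [])    _              _    = [] ∷ []
adjacentFree⇒avoids132 (_ ∷ y ∷ π) (_ ∷ w!@(y≢ ∷ _)) free = avoids-∷ y≢
  (All.map⁺ (VecAll.toList⁺ (VecAll.lookup⁻ λ j → free 0F 1F (Fin.suc (Fin.suc j)) refl (s≤s z<s))))
  (adjacentFree⇒avoids132 (y ∷ π) w!
    λ i i′ j eq i′<j → free (Fin.suc i) (Fin.suc i′) (Fin.suc j) (cong suc eq) (s≤s i′<j))

avoids132⇒adjacentFree : (π : Vec (Fin n) l) → Avoids132 (word π) → AdjacentFree π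
avoids132⇒adjacentFree (_ ∷ π) (as ∷ _)  Fin.zero    (Fin.suc i′) (Fin.suc j) _  (s≤s i′<j) (p , q) =
  allPairs-lookup⁺ (allPairs-toList⁻ {xs = π} (AllPairs.map⁻ as)) i′<j (p , q)
avoids132⇒adjacentFree (_ ∷ π) (_ ∷ av) (Fin.suc i) (Fin.suc i′) (Fin.suc j) eq (s≤s i′<j) =
  avoids132⇒adjacentFree π av i i′ j (suc-injective eq) i′<j
avoids132⇒adjacentFree (_ ∷ π) _ Fin.zero Fin.zero _ ()
avoids132⇒adjacentFree (_ ∷ π) _ (Fin.suc _) Fin.zero _ ()

-- The pattern (k-1)...1k

lookup-∷ʳ-inject₁ : ∀ (xs : Vec A n) x i → lookup (xs Vec.∷ʳ x) (inject₁ i) ≡ lookup xs i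
lookup-∷ʳ-inject₁ (_ ∷ _)  _ Fin.zero    = refl
lookup-∷ʳ-inject₁ (_ ∷ xs) x (Fin.suc i) = lookup-∷ʳ-inject₁ xs x i

lookup-∷ʳ-fromℕ : ∀ (xs : Vec A n) x → lookup (xs Vec.∷ʳ x) (fromℕ n) ≡ x
lookup-∷ʳ-fromℕ []       _ = refl
lookup-∷ʳ-fromℕ (_ ∷ xs) x = lookup-∷ʳ-fromℕ xs x

lookup-reverse-opposite : ∀ (xs : Vec A n) i → lookup (Vec.reverse xs) (opposite i) ≡ lookup xs i
lookup-reverse-opposite (x ∷ xs) i =
  trans (cong (λ ys → lookup ys (opposite i)) (Vec.reverse-∷ x xs)) (snoc i)
  where
  snoc : ∀ i → lookup (Vec.reverse xs Vec.∷ʳ x) (opposite i) ≡ lookup (x ∷ xs) i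
  snoc Fin.zero    = lookup-∷ʳ-fromℕ (Vec.reverse xs) x
  snoc (Fin.suc i) = trans (lookup-∷ʳ-inject₁ (Vec.reverse xs) x (opposite i)) (lookup-reverse-opposite xs i)

lookup-reverse-allFin : ∀ (i : Fin n) → lookup (Vec.reverse (Vec.allFin n)) i ≡ opposite i
lookup-reverse-allFin {n} i = begin
  lookup ρ i                        ≡⟨ cong (lookup ρ) (Fin.opposite-involutive i) ⟨
  lookup ρ (opposite (opposite i))  ≡⟨ lookup-reverse-opposite (Vec.allFin n) (opposite i) ⟩
  lookup (Vec.allFin n) (opposite i) ≡⟨ Vec.lookup-allFin (opposite i) ⟩
  opposite i                        ∎
  where
  open ≡-Reasoning
  ρ = Vec.reverse (Vec.allFin n)

pattern-descent : ∀ k i → lookup (descentsThenMax (suc k)) (inject₁ i) ≡ inject₁ (opposite i)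
pattern-descent k i = begin
  lookup (Vec.map inject₁ ρ Vec.∷ʳ fromℕ k) (inject₁ i)   ≡⟨ lookup-∷ʳ-inject₁ (Vec.map inject₁ ρ) (fromℕ k) i ⟩
  lookup (Vec.map inject₁ ρ) i                            ≡⟨ Vec.lookup-map i inject₁ ρ ⟩
  inject₁ (lookup ρ i)                                    ≡⟨ cong inject₁ (lookup-reverse-allFin i) ⟩
  inject₁ (opposite i)                                    ∎
  where
  open ≡-Reasoning
  ρ = Vec.reverse (Vec.allFin k)

pattern-max : ∀ k → lookup (descentsThenMax (suc k)) (fromℕ k) ≡ fromℕ k
pattern-max k = lookup-∷ʳ-fromℕ (Vec.map inject₁ (Vec.reverse (Vec.allFin k))) (fromℕ k)

opposite-antitone : ∀ {i j : Fin n} → i Fin.< j → opposite j Fin.< opposite i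
opposite-antitone {i = i} {j} i<j =
  subst₂ _<_ (sym (Fin.opposite-prop j)) (sym (Fin.opposite-prop i)) (∸-monoʳ-< (s≤s i<j) (Fin.toℕ<n j))

opposite-antitone⁻ : ∀ {i j : Fin n} → opposite j Fin.< opposite i → i Fin.< j
opposite-antitone⁻ {i = i} {j} lt =
  subst₂ Fin._<_ (Fin.opposite-involutive i) (Fin.opposite-involutive j) (opposite-antitone lt)

module _ {n k} (q : Vec (Fin n) k) (t : Fin n) where

  iso-descentsThenMax⁻ : OrderIsomorphic (q Vec.∷ʳ t) (descentsThenMax (suc k)) →
                         AllPairs _>_ (word q) × All (_< toℕ t) (word q)
  iso-descentsThenMax⁻ iso =
    AllPairs.map⁺ (allPairs-toList⁺ (allPairs-lookup⁻ descends)) ,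
    All.map⁺ (VecAll.toList⁺ (VecAll.lookup⁻ below))
    where
    descends : ∀ {i j} → i Fin.< j → lookup q i Fin.> lookup q j
    descends {i} {j} i<j =
      subst₂ Fin._<_ (lookup-∷ʳ-inject₁ q t j) (lookup-∷ʳ-inject₁ q t i)
        (Equivalence.from (iso (inject₁ j) (inject₁ i))
          (subst₂ Fin._<_ (sym (pattern-descent k j)) (sym (pattern-descent k i))
            (subst₂ _<_ (sym (Fin.toℕ-inject₁ (opposite j))) (sym (Fin.toℕ-inject₁ (opposite i)))
              (opposite-antitone i<j))))
    below : ∀ i → lookup q i Fin.< t
    below i =
      subst₂ Fin._<_ (lookup-∷ʳ-inject₁ q t i) (lookup-∷ʳ-fromℕ q t)
        (Equivalence.from (iso (inject₁ i) (fromℕ k))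
          (subst₂ Fin._<_ (sym (pattern-descent k i)) (sym (pattern-max k))
            (subst₂ _<_ (sym (Fin.toℕ-inject₁ (opposite i))) (sym (Fin.toℕ-fromℕ k))
              (Fin.toℕ<n (opposite i)))))

  iso-descentsThenMax⁺ : AllPairs _>_ (word q) → All (_< toℕ t) (word q) →
                         OrderIsomorphic (q Vec.∷ʳ t) (descentsThenMax (suc k))
  iso-descentsThenMax⁺ q> q<t = orderIsomorphic-intro (q Vec.∷ʳ t) p mono inj
    where
    p = descentsThenMax (suc k)
    mono : ∀ i j → lookup p i Fin.< lookup p j → lookup (q Vec.∷ʳ t) i Fin.< lookup (q Vec.∷ʳ t) j
    mono i j lt with view i | view j
    ... | ‵inject₁ i | ‵inject₁ j =
      subst₂ Fin._<_ (sym (lookup-∷ʳ-inject₁ q t i)) (sym (lookup-∷ʳ-inject₁ q t j))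
        (allPairs-lookup⁺ (allPairs-toList⁻ {xs = q} (AllPairs.map⁻ q>))
          (opposite-antitone⁻ (subst₂ _<_ (Fin.toℕ-inject₁ (opposite i)) (Fin.toℕ-inject₁ (opposite j))
            (subst₂ Fin._<_ (pattern-descent k i) (pattern-descent k j) lt))))
    ... | ‵inject₁ i | ‵fromℕ =
      subst₂ Fin._<_ (sym (lookup-∷ʳ-inject₁ q t i)) (sym (lookup-∷ʳ-fromℕ q t))
        (VecAll.lookup⁺ (VecAll.toList⁻ {xs = q} (All.map⁻ q<t)) i)
    ... | ‵fromℕ | _ =
      contradiction (subst (Fin._< lookup p j) (pattern-max k) lt) (≤⇒≯ (Fin.≤fromℕ (lookup p j)))
    inj : ∀ i j → lookup p i ≡ lookup p j → i ≡ j
    inj i j eq with view i | view j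
    ... | ‵inject₁ i | ‵inject₁ j = cong inject₁ (begin
      i                       ≡⟨ Fin.opposite-involutive i ⟨
      opposite (opposite i)   ≡⟨ cong opposite (Fin.inject₁-injective
                                   (trans (sym (pattern-descent k i)) (trans eq (pattern-descent k j)))) ⟩
      opposite (opposite j)   ≡⟨ Fin.opposite-involutive j ⟩
      j                       ∎)
      where open ≡-Reasoning
    ... | ‵inject₁ i | ‵fromℕ =
      contradiction (trans (sym (pattern-max k)) (trans (sym eq) (pattern-descent k i))) Fin.fromℕ≢inject₁
    ... | ‵fromℕ | ‵inject₁ j =
      contradiction (trans (sym (pattern-max k)) (trans eq (pattern-descent k j))) Fin.fromℕ≢inject₁
    ... | ‵fromℕ | ‵fromℕ = refl

++-injective : ∀ (xs ys : List A) {xs′ ys′} → length xs ≡ length ys → xs ++ xs′ ≡ ys ++ ys′ →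
               xs ≡ ys × xs′ ≡ ys′
++-injective []       []       _   eq = refl , eq
++-injective (_ ∷ xs) (_ ∷ ys) len eq
  with refl , eqs ← ∷-injective eq
  with refl , eq′ ← ++-injective xs ys (suc-injective len) eqs = refl , eq′

iso⇒descentsThenMax : ∀ (k<n : k < n) {π : Vec (Fin n) n} →
  OrderIsomorphic (truncate k<n π) (descentsThenMax (suc k)) → DescentsThenMax k (word π)
iso⇒descentsThenMax {k} k<n {π} iso
  with r , eq ← word-truncate k<n π
  with q , t , eq′ ← Vec.initLast (truncate k<n π)
  with q> , q<t ← iso-descentsThenMax⁻ q t
         (subst (λ σ → OrderIsomorphic σ (descentsThenMax (suc k))) eq′ iso) =
  word q , toℕ t , r ,
  trans eq (trans (cong (λ σ → word σ ++ r) eq′) (trans (cong (_++ r) (word-∷ʳ q t)) (++-assoc (word q) _ r))) ,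
  length-word q , q> , q<t

beginsWith⇒descentsThenMax : ∀ {π : Vec (Fin n) n} → k < n →
  BeginsWith (descentsThenMax (suc k)) π → DescentsThenMax k (word π)
beginsWith⇒descentsThenMax _   (inj₁ (k<n , iso))  = iso⇒descentsThenMax k<n iso
-- The convention concerns only n = 0, which k < n excludes.
beginsWith⇒descentsThenMax k<n (inj₂ (refl , refl)) = contradiction k<n λ ()

descentsThenMax⇒beginsWith : ∀ {π : Vec (Fin n) n} → k < n →
  DescentsThenMax k (word π) → BeginsWith (descentsThenMax (suc k)) π
descentsThenMax⇒beginsWith {n} {k} {π} k<n (q , t , r , eq , |q|≡k , q> , q<t)
  with r′ , eq₁ ← word-truncate k<n π
  with q′ , t′ , eq₂ ← Vec.initLast (truncate k<n π)
  -- Both decompositions cut off k letters, so they agree.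
  with refl , eq₃ ← ++-injective (word q′) q {[ toℕ t′ ] ++ r′} {t ∷ r} (trans (length-word q′) (sym |q|≡k))
         (trans (sym (trans eq₁ (trans (cong (λ σ → word σ ++ r′) eq₂)
           (trans (cong (_++ r′) (word-∷ʳ q′ t′)) (++-assoc (word q′) _ r′))))) eq)
  with refl ← ∷-injectiveˡ eq₃ =
  inj₁ (k<n , subst (λ σ → OrderIsomorphic σ (descentsThenMax (suc k))) (sym eq₂)
                (iso-descentsThenMax⁺ q′ t′ q> q<t))

permutation⇒completes : {π : Vec (Fin n) n} → IsPermutation π → Avoids13-2 π → Completes n [] (word π)
permutation⇒completes {π = π} π! av = record
  { ∈⁻     = λ x∈ → inj₁ (letter< π x∈)
  ; ∈⁺     = λ { (inj₁ x<n) → permutation-surjective π! x<n ; (inj₂ ()) }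
  ; unique = word-unique⁺ π!
  ; avoids = adjacentFree⇒avoids132 π (word-unique⁺ π!) (avoids13-2⇒adjacentFree {π = π} av)
  -- Vacuous: no letter reaches n.
  ; rises  = All⇒rises (All.tabulate (letter< π))
  }
  where
  All⇒rises : All (_< n) w → RisesFrom n w
  All⇒rises []         = []
  All⇒rises (_ ∷ w<)   = All.map (λ z<n n≤z → contradiction n≤z (<⇒≱ z<n)) w< ∷ All⇒rises w<

completes⇒permutation : {π : Vec (Fin n) n} → Completes n [] (word π) → IsPermutation π × Avoids13-2 π
completes⇒permutation {π = π} cpl =
  word-unique⁻ (Completes.unique cpl) ,
  adjacentFree⇒avoids13-2 {π = π} (avoids132⇒adjacentFree π (Completes.avoids cpl))

-- Counting

words-unique : ∀ m n → Unique (words m n)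
words-unique m zero    = [] ∷ []
words-unique m (suc n) = Unique.cartesianProductWith⁺ _∷_ Vec.∷-injective (Unique.allFin⁺ m) (words-unique m n)

words-complete : (π : Vec (Fin m) n) → π ∈ words m n
words-complete []      = here refl
words-complete (x ∷ π) = ∈-cartesianProductWith⁺ _∷_ (∈-allFin x) (words-complete π)

-- Duplicate-free lists with the same members are rearrangements of each other, so no explicit
-- bijection has to be inverted.
same-length : {xs ys : List A} → Unique xs → Unique ys → (∀ {x} → x ∈ xs ⇔ x ∈ ys) → length xs ≡ length ys
same-length xs! ys! eq = ↭-length (∼bag⇒↭ (unique∧set⇒bag xs! ys! eq))

beginning : ∀ k n → List (Vec (Fin n) n)
beginning k n = filter (beginsWith? (descentsThenMax (suc k))) (filter avoids13-2? (permutations n))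

∈beginning⁻ : ∀ k n {π} → k < n → π ∈ beginning k n → Completes n [] (word π) × DescentsThenMax k (word π)
∈beginning⁻ k n k<n π∈ =
  let π∈ᵃ , begins = ∈-filter⁻ (beginsWith? (descentsThenMax (suc k)))
                       {xs = filter avoids13-2? (permutations n)} π∈
      π∈ᵖ , av     = ∈-filter⁻ avoids13-2? {xs = permutations n} π∈ᵃ
      _   , π!     = ∈-filter⁻ isPermutation? {xs = words n n} π∈ᵖ
  in permutation⇒completes π! av , beginsWith⇒descentsThenMax k<n begins

∈beginning⁺ : ∀ k n {π} → k < n → Completes n [] (word π) → DescentsThenMax k (word π) → π ∈ beginning k n
∈beginning⁺ k n {π} k<n cpl dtm =
  let π! , av = completes⇒permutation cpl
  in ∈-filter⁺ (beginsWith? (descentsThenMax (suc k)))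
       (∈-filter⁺ avoids13-2? (∈-filter⁺ isPermutation? (words-complete π) π!) av)
       (descentsThenMax⇒beginsWith k<n dtm)

beginning-unique : ∀ k n → Unique (beginning k n)
beginning-unique k n = Unique.filter⁺ (beginsWith? (descentsThenMax (suc k)))
  (Unique.filter⁺ avoids13-2? (Unique.filter⁺ isPermutation? (words-unique n n)))

-- That v has exactly n letters is read off from the run that outputs it.
completes⇒word : Completes n [] v → Σ[ π ∈ Vec (Fin n) n ] word π ≡ v
completes⇒word {n} cpl = word-surjective (All.tabulate (letters< cpl))
  (trans (run-length (completes⇒run n [] _ [] [] cpl)) (+-identityʳ n))

module _ (m k n : ℕ) (n≡ : n ≡ suc (m + k)) where

  private
    k<n : k < n
    k<n = subst (k <_) (sym n≡) (s≤s (m≤n+m k m))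

  word∈openings : v ∈ map word (beginning k n) → v ∈ openings k m 0
  word∈openings v∈ with π , π∈ , refl ← ∈-map⁻ word v∈ =
    let cpl , dtm = ∈beginning⁻ k n k<n π∈
    in completes⇒∈openings k m (subst (λ i → Completes i [] (word π)) n≡ cpl) dtm

  openings∈word : v ∈ openings k m 0 → v ∈ map word (beginning k n)
  openings∈word {v} v∈ =
    let cpl′ , dtm = ∈openings⇒completes k m v∈
        cpl        = subst (λ i → Completes i [] v) (sym n≡) cpl′
        π , π≡v    = completes⇒word cpl
    in subst (_∈ map word (beginning k n)) π≡v (∈-map⁺ word
         (∈beginning⁺ k n k<n (subst (Completes n []) (sym π≡v) cpl) (subst (DescentsThenMax k) (sym π≡v) dtm)))

  length-beginning : length (beginning k n) ≡ catalan (suc m)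
  length-beginning = begin
    length (beginning k n)              ≡⟨ length-map word (beginning k n) ⟨
    length (map word (beginning k n))   ≡⟨ same-length (Unique.map⁺ word-injective (beginning-unique k n))
                                             (openings-unique k m 0) (mk⇔ word∈openings openings∈word) ⟩
    length (openings k m 0)             ≡⟨ length-openings k m 0 ⟩
    ballot 0 (suc m)                    ≡⟨ catalan≡ballot (suc m) ⟨
    catalan (suc m)                     ∎
    where open ≡-Reasoning

N-low : ∀ k n .{{_ : NonZero k}} → ¬ (k ≡ 1 × n ≡ 0) → n < k → N (descentsThenMax k) n ≡ 0
N-low k n ¬conv n<k = cong length (filter-none (beginsWith? (descentsThenMax k))
  {filter avoids13-2? (permutations n)}
  (All.tabulate λ _ → λ { (inj₁ (k≤n , _)) → <⇒≱ n<k k≤n ; (inj₂ conv) → ¬conv conv }))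

N-high : ∀ k n → suc k ≤ n → N (descentsThenMax (suc k)) n ≡ catalan (n ∸ k)
N-high k n k<n =
  trans (length-beginning (n ∸ suc k) k n (sym (trans (sym (+-suc (n ∸ suc k) k)) (m∸n+n≡m k<n))))
        (cong catalan (sym (+-∸-assoc 1 k<n)))

N≡shift : ∀ k n .{{_ : NonZero k}} → ¬ (k ≡ 1 × n ≡ 0) → N (descentsThenMax k) n ≡ (X ^ˢ k ⊛ C ^ˢ 2) n
N≡shift (suc k) n ¬conv with <-≤-connex n (suc k)
... | inj₁ n<k = trans (N-low (suc k) n ¬conv n<k) (sym (X^⊛-low (suc k) (C ^ˢ 2) n n<k))
... | inj₂ k<n = begin
  N (descentsThenMax (suc k)) n                       ≡⟨ N-high k n k<n ⟩
  catalan (n ∸ k)                                     ≡⟨ cong catalan (+-∸-assoc 1 k<n) ⟩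
  catalan (suc (n ∸ suc k))                           ≡⟨ C²≗catalan∘suc (n ∸ suc k) ⟨
  (C ^ˢ 2) (n ∸ suc k)                                ≡⟨ X^⊛-shift (suc k) (C ^ˢ 2) (n ∸ suc k) ⟨
  (X ^ˢ suc k ⊛ C ^ˢ 2) (n ∸ suc k + suc k)           ≡⟨ cong (X ^ˢ suc k ⊛ C ^ˢ 2) (m∸n+n≡m k<n) ⟩
  (X ^ˢ suc k ⊛ C ^ˢ 2) n                             ∎
  where open ≡-Reasoning

-- By the convention the empty permutation begins with the pattern 1, so for k = 1 the coefficient
-- of x^0 is 1, whereas x C² has 0 there. This single coefficient accounts for the summand `1ˢ` and
-- for the exclusion of k = 1, n = 0 from the formula for N.
proposition17 : (k : ℕ) .{{_ : NonZero k}} →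
    ((k ≢ 1 → G (descentsThenMax k) ≗ X ^ˢ k ⊛ C ^ˢ 2) ×
    (k ≡ 1 → G (descentsThenMax k) ≗ 1ˢ ⊕ X ^ˢ k ⊛ C ^ˢ 2)) ×
    ((n : ℕ) → ¬ (k ≡ 1 × n ≡ 0) →
    (k ≤ n → N (descentsThenMax k) n ≡ catalan (n ∸ (k ∸ 1))) ×
    (n < k → N (descentsThenMax k) n ≡ 0))
proposition17 k@(suc k-1) =
  ((λ k≢1 n → N≡shift k n (λ (k≡1 , _) → k≢1 k≡1)) ,
   (λ { refl zero    → refl
      ; refl (suc n) → N≡shift 1 (suc n) λ () })) ,
  λ n ¬conv → N-high k-1 n , N-low k n ¬conv
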